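{- Let $\kappa\geq\aleph_1$ be a cardinal and let $\Omega$ be a monoid whose underlying set lies in $\mathbf{Set}_\kappa$. Then the category $\mathrm{Trisk}_\Omega(\mathbf{Set}_\kappa)$, with the monoidal product $\oplus$ (unit $\emptyset$) and the trace operation $\mathrm{Tr}$ described below, is a traced monoidal category.
   Context: $\mathbf{Set}_\kappa$ is the category of sets of cardinality less than $\kappa$. A triskell from $S$ to $T$ with weights in a monoid $(\Omega,\cdot,1)$ is a tuple $(E,S,T,\Omega,s,t,w)$ of sets $E,S,T$ and maps $s:E\to S$, $t:E\to T$, $w:E\to\Omega$ (elements of $E$ are called edges). The composite of $(E,S,T,\Omega,s,t,w)$ and $(E',T,T',\Omega,s',t',w')$ is the triskell from $S$ to $T'$ with edge set the pullback $P=\{(e,e')\in E\times E' : t(e)=s'(e')\}$, source $(e,e')\mapsto s(e)$, target $(e,e')\mapsto t'(e')$ and weight $(e,e')\mapsto w(e)\cdot w'(e')$. The category $\mathrm{Trisk}_\Omega(\mathbf{Set}_\kappa)$ has as objects the sets of $\mathbf{Set}_\kappa$ and as morphisms from $S$ to $T$ the triskells from $S$ to $T$ taken up to isomorphism (bijections of edge sets commuting with source, target and weight maps); the identity on $X$ is $(X,X,X,\Omega,\mathrm{id},\mathrm{id},x\mapsto 1)$. The monoidal product $\oplus$ sends triskells $(E,S,T,\Omega,s,t,w)$ and $(E',S',T',\Omega,s',t',w')$ to $(E+E',S+S',T+T',\Omega,s+s',t+t',(w,w'))$ (disjoint unions, with the weight given by $w$ on $E$ and $w'$ on $E'$); its unit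 $\emptyset$ is the empty set (the triskell with empty edge set on empty sets). Trace: given a triskell $T=(E,X+U,Y+U,\Omega,s,t,w)$, $\mathrm{Tr}_U(T)$ is the triskell from $X$ to $Y$ whose edges are the finite sequences $(e_1,\dots,e_k)$, $k\geq1$, of edges of $T$ with $s(e_1)\in X$, $t(e_i)=s(e_{i+1})\in U$ for $1\leq i<k$ and $t(e_k)\in Y$, with source $s(e_1)$, target $t(e_k)$ and weight $w(e_1)\cdot w(e_2)\cdots w(e_k)$ (the triskell of all finite paths from $X$ to $Y$ in $T$). -}

module Defs where

open import Level using (Level; _⊔_; suc)
open import Algebra.Core using (Op₂)
open import Data.Empty.Polymorphic using (⊥; ⊥-elim)
open import Data.Irrelevant as Irrelevant using (Irrelevant)
open import Data.Nat.Base using (ℕ)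
open import Data.Product.Base using (Σ-syntax; _×_; _,_; proj₁; proj₂)
open import Data.Refinement using (Refinement-syntax; value; proof; _,_)
open import Data.Sum.Base as Sum using (_⊎_; inj₁; inj₂; [_,_]′)
open import Function.Base using (id; const; _∘_)
open import Function.Bundles using (_↣_; _↔_; _⇔_; mk⇔; Inverse)
open import Function.Construct.Composition using (_↣-∘_)
open import Relation.Binary.PropositionalEquality.Core using (_≡_)
open import Relation.Binary.Structures using (IsEquivalence)
open import Relation.Nullary.Negation.Core using (¬_)

private
  variable
    a b ℓ : Level

------------------------------------------------------------------------
-- Cardinals: a type stands for its own cardinality.

infix 4 _≺_

_≺_ : Set a → Set b → Set (a ⊔ b)
A ≺ B = (A ↣ B) × ¬ (B ↣ A)

-- ℵ₁ is the successor of ℵ₀, the least cardinal above it, so κ ≥ ℵ₁ says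
-- that κ lies strictly above ℵ₀ (see ≥ℵ₁⇔).
_≥ℵ₁ : Set a → Set a
κ ≥ℵ₁ = ℕ ≺ κ

record Isℵ₁ (A : Set a) : Set (suc a) where
  field
    above-ℵ₀ : ℕ ≺ A
    least    : (B : Set a) → ℕ ≺ B → A ↣ B

≥ℵ₁⇔ : {A κ : Set a} → Isℵ₁ A → (κ ≥ℵ₁) ⇔ (A ↣ κ)
≥ℵ₁⇔ {κ = κ} ℵ₁ = mk⇔ (least κ)
  (λ A↣κ → A↣κ ↣-∘ proj₁ above-ℵ₀ , λ κ↣ℕ → proj₂ above-ℵ₀ (κ↣ℕ ↣-∘ A↣κ))
  where open Isℵ₁ ℵ₁

-- The objects of Set_κ.
SetBelow : Set ℓ → Set (suc ℓ)
SetBelow {ℓ} κ = [ X ∈ Set ℓ ∣ X ≺ κ ]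

------------------------------------------------------------------------
-- Traced (symmetric) monoidal categories. Hom-sets are setoids, and
-- composition is written in diagrammatic order.

record RawTracedMonoidalCategory (o h e : Level) : Set (suc (o ⊔ h ⊔ e)) where
  infix  4 _⇒_ _≈_
  infixl 6 _⨾_
  infixr 7 _⊗₀_ _⊗₁_
  field
    Obj  : Set o
    _⇒_  : Obj → Obj → Set h
    _≈_  : ∀ {A B} → A ⇒ B → A ⇒ B → Set e
    idn  : ∀ A → A ⇒ A
    _⨾_  : ∀ {A B C} → A ⇒ B → B ⇒ C → A ⇒ C

    unit : Obj
    _⊗₀_ : Obj → Obj → Obj
    _⊗₁_ : ∀ {A B C D} → A ⇒ B → C ⇒ D → A ⊗₀ C ⇒ B ⊗₀ D
    α⇒   : ∀ A B C → (A ⊗₀ B) ⊗₀ C ⇒ A ⊗₀ (B ⊗₀ C)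
    α⇐   : ∀ A B C → A ⊗₀ (B ⊗₀ C) ⇒ (A ⊗₀ B) ⊗₀ C
    λ⇒   : ∀ A → unit ⊗₀ A ⇒ A
    λ⇐   : ∀ A → A ⇒ unit ⊗₀ A
    ρ⇒   : ∀ A → A ⊗₀ unit ⇒ A
    ρ⇐   : ∀ A → A ⇒ A ⊗₀ unit
    σ    : ∀ A B → A ⊗₀ B ⇒ B ⊗₀ A

    Tr   : ∀ {X Y} U → X ⊗₀ U ⇒ Y ⊗₀ U → X ⇒ Y

module _ {o h e} (C : RawTracedMonoidalCategory o h e) where
  open RawTracedMonoidalCategory C

  record IsCategory : Set (o ⊔ h ⊔ e) where
    field
      isEquivalence : ∀ {A B} → IsEquivalence (_≈_ {A} {B})
      ⨾-cong    : ∀ {A B C} {f f′ : A ⇒ B} {g g′ : B ⇒ C} →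
                  f ≈ f′ → g ≈ g′ → f ⨾ g ≈ f′ ⨾ g′
      assoc     : ∀ {A B C D} (f : A ⇒ B) (g : B ⇒ C) (k : C ⇒ D) →
                  (f ⨾ g) ⨾ k ≈ f ⨾ (g ⨾ k)
      identityˡ : ∀ {A B} (f : A ⇒ B) → idn A ⨾ f ≈ f
      identityʳ : ∀ {A B} (f : A ⇒ B) → f ⨾ idn B ≈ f

  record IsMonoidal : Set (o ⊔ h ⊔ e) where
    field
      ⊗-cong : ∀ {A B C D} {f f′ : A ⇒ B} {g g′ : C ⇒ D} →
               f ≈ f′ → g ≈ g′ → f ⊗₁ g ≈ f′ ⊗₁ g′
      ⊗-idn  : ∀ A B → idn A ⊗₁ idn B ≈ idn (A ⊗₀ B)
      ⊗-⨾    : ∀ {A B C A′ B′ C′} (f : A ⇒ B) (g : B ⇒ C)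
               (f′ : A′ ⇒ B′) (g′ : B′ ⇒ C′) →
               (f ⨾ g) ⊗₁ (f′ ⨾ g′) ≈ (f ⊗₁ f′) ⨾ (g ⊗₁ g′)

      α-invˡ : ∀ A B C → α⇐ A B C ⨾ α⇒ A B C ≈ idn (A ⊗₀ (B ⊗₀ C))
      α-invʳ : ∀ A B C → α⇒ A B C ⨾ α⇐ A B C ≈ idn ((A ⊗₀ B) ⊗₀ C)
      λ-invˡ : ∀ A → λ⇐ A ⨾ λ⇒ A ≈ idn A
      λ-invʳ : ∀ A → λ⇒ A ⨾ λ⇐ A ≈ idn (unit ⊗₀ A)
      ρ-invˡ : ∀ A → ρ⇐ A ⨾ ρ⇒ A ≈ idn A
      ρ-invʳ : ∀ A → ρ⇒ A ⨾ ρ⇐ A ≈ idn (A ⊗₀ unit)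

      α-natural : ∀ {A B C A′ B′ C′} (f : A ⇒ A′) (g : B ⇒ B′) (k : C ⇒ C′) →
                  ((f ⊗₁ g) ⊗₁ k) ⨾ α⇒ A′ B′ C′ ≈ α⇒ A B C ⨾ (f ⊗₁ (g ⊗₁ k))
      λ-natural : ∀ {A B} (f : A ⇒ B) → (idn unit ⊗₁ f) ⨾ λ⇒ B ≈ λ⇒ A ⨾ f
      ρ-natural : ∀ {A B} (f : A ⇒ B) → (f ⊗₁ idn unit) ⨾ ρ⇒ B ≈ ρ⇒ A ⨾ f

      triangle : ∀ A B → α⇒ A unit B ⨾ (idn A ⊗₁ λ⇒ B) ≈ ρ⇒ A ⊗₁ idn B
      pentagon : ∀ A B C D →
                 α⇒ (A ⊗₀ B) C D ⨾ α⇒ A B (C ⊗₀ D) ≈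
                 (α⇒ A B C ⊗₁ idn D) ⨾ α⇒ A (B ⊗₀ C) D ⨾ (idn A ⊗₁ α⇒ B C D)

  record IsSymmetric : Set (o ⊔ h ⊔ e) where
    field
      σ-natural    : ∀ {A B A′ B′} (f : A ⇒ A′) (g : B ⇒ B′) →
                     (f ⊗₁ g) ⨾ σ A′ B′ ≈ σ A B ⨾ (g ⊗₁ f)
      σ-involutive : ∀ A B → σ A B ⨾ σ B A ≈ idn (A ⊗₀ B)
      hexagon      : ∀ A B C →
                     α⇒ A B C ⨾ σ A (B ⊗₀ C) ⨾ α⇒ B C A ≈
                     (σ A B ⊗₁ idn C) ⨾ α⇒ B A C ⨾ (idn B ⊗₁ σ A C)

  -- The Joyal–Street–Verity axioms, in the symmetric (identity twist) case.
  record IsTraced : Set (o ⊔ h ⊔ e) where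
    field
      Tr-cong : ∀ {X Y U} {f g : X ⊗₀ U ⇒ Y ⊗₀ U} → f ≈ g → Tr U f ≈ Tr U g
      naturalˡ : ∀ {X′ X Y U} (g : X′ ⇒ X) (f : X ⊗₀ U ⇒ Y ⊗₀ U) →
                 Tr U ((g ⊗₁ idn U) ⨾ f) ≈ g ⨾ Tr U f
      naturalʳ : ∀ {X Y Y′ U} (f : X ⊗₀ U ⇒ Y ⊗₀ U) (g : Y ⇒ Y′) →
                 Tr U (f ⨾ (g ⊗₁ idn U)) ≈ Tr U f ⨾ g
      sliding  : ∀ {X Y U V} (f : X ⊗₀ U ⇒ Y ⊗₀ V) (g : V ⇒ U) →
                 Tr U (f ⨾ (idn Y ⊗₁ g)) ≈ Tr V ((idn X ⊗₁ g) ⨾ f)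
      vanishing-unit : ∀ {X Y} (f : X ⊗₀ unit ⇒ Y ⊗₀ unit) →
                       Tr unit f ≈ ρ⇐ X ⨾ f ⨾ ρ⇒ Y
      vanishing-⊗ : ∀ {X Y U V} (f : X ⊗₀ (U ⊗₀ V) ⇒ Y ⊗₀ (U ⊗₀ V)) →
                    Tr (U ⊗₀ V) f ≈ Tr U (Tr V (α⇒ X U V ⨾ f ⨾ α⇐ Y U V))
      superposing : ∀ {W Z X Y U} (g : W ⇒ Z) (f : X ⊗₀ U ⇒ Y ⊗₀ U) →
                    Tr U (α⇒ W X U ⨾ (g ⊗₁ f) ⨾ α⇐ Z Y U) ≈ g ⊗₁ Tr U f
      yanking : ∀ U → Tr U (σ U U) ≈ idn U

  record IsTracedMonoidalCategory : Set (o ⊔ h ⊔ e) where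
    field
      isCategory  : IsCategory
      isMonoidal  : IsMonoidal
      isSymmetric : IsSymmetric
      isTraced    : IsTraced

------------------------------------------------------------------------
-- Triskells

module Triskells {ℓ} {Ω : Set ℓ} (_·_ : Op₂ Ω) (ε : Ω) where

  record Triskell (S T : Set ℓ) : Set (suc ℓ) where
    field
      Edge   : Set ℓ
      source : Edge → S
      target : Edge → T
      weight : Edge → Ω

  open Triskell public

  private
    variable
      S T S′ T′ X Y U : Set ℓ

  infix 4 _≅_

  record _≅_ (F G : Triskell S T) : Set ℓ where
    field
      edges : Edge F ↔ Edge G
    open Inverse edges public using (to; from)
    field
      source-to : ∀ e → source G (to e) ≡ source F e
      target-to : ∀ e → target G (to e) ≡ target F e
      weight-to : ∀ e → weight G (to e) ≡ weight F e

  -- The triskell of a map; all structural morphisms have this form.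
  graph : (S → T) → Triskell S T
  graph {S} f = record
    { Edge = S ; source = id ; target = f ; weight = const ε }

  compose : Triskell S T → Triskell T T′ → Triskell S T′
  compose F G = record
    { Edge   = Σ[ (e , e′) ∈ Edge F × Edge G ] target F e ≡ source G e′
    ; source = λ ((e , _) , _) → source F e
    ; target = λ ((_ , e′) , _) → target G e′
    ; weight = λ ((e , e′) , _) → weight F e · weight G e′
    }

  _⊕_ : Triskell S T → Triskell S′ T′ → Triskell (S ⊎ S′) (T ⊎ T′)
  F ⊕ G = record
    { Edge   = Edge F ⊎ Edge G
    ; source = Sum.map (source F) (source G)
    ; target = Sum.map (target F) (target G)
    ; weight = [ weight F , weight G ]′
    }

  -- Path F p y: the nonempty sequences of consecutive edges of F that start
  -- at p, pass from each edge to the next through U, and end at y in Y.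
  data Path (F : Triskell (X ⊎ U) (Y ⊎ U)) (p : X ⊎ U) (y : Y) : Set ℓ where
    last : (e : Edge F) → source F e ≡ p → target F e ≡ inj₁ y → Path F p y
    cons : (e : Edge F) {u : U} → source F e ≡ p → target F e ≡ inj₂ u →
           Path F (inj₂ u) y → Path F p y

  pathWeight : {F : Triskell (X ⊎ U) (Y ⊎ U)} {p : X ⊎ U} {y : Y} →
               Path F p y → Ω
  pathWeight {F = F} (last e _ _)   = weight F e
  pathWeight {F = F} (cons e _ _ π) = weight F e · pathWeight π

  trace : Triskell (X ⊎ U) (Y ⊎ U) → Triskell X Y
  trace {X = X} {Y = Y} F = record
    { Edge   = Σ[ (x , y) ∈ X × Y ] Path F (inj₁ x) y
    ; source = λ ((x , _) , _) → x
    ; target = λ ((_ , y) , _) → y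
    ; weight = λ (_ , π) → pathWeight π
    }

  -- Set_κ is closed under the constructions used by the operations, that is,
  -- the operations are well defined on Trisk_Ω(Set_κ).
  record Closed (κ : Set ℓ) : Set (suc ℓ) where
    field
      ⊥-small       : ⊥ {ℓ} ≺ κ
      ⊎-small       : {A B : Set ℓ} → A ≺ κ → B ≺ κ → (A ⊎ B) ≺ κ
      compose-small : (F : Triskell S T) (G : Triskell T T′) →
                      Edge F ≺ κ → Edge G ≺ κ → Edge (compose F G) ≺ κ
      trace-small   : (F : Triskell (X ⊎ U) (Y ⊎ U)) →
                      Edge F ≺ κ → Edge (trace F) ≺ κ

  module _ {κ : Set ℓ} (closed : Closed κ) where
    open Closed closed

    Trisk : RawTracedMonoidalCategory (suc ℓ) (suc ℓ) ℓ
    Trisk = record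
      { Obj  = SetBelow κ
      ; _⇒_  = Hom
      ; _≈_  = λ F G → value F ≅ value G
      ; idn  = λ A → structural A A id
      ; _⨾_  = λ (F , p) (G , q) →
                 compose F G , Irrelevant.zipWith (compose-small F G) p q
      ; unit = ∅
      ; _⊗₀_ = _+_
      ; _⊗₁_ = λ (F , p) (G , q) → F ⊕ G , Irrelevant.zipWith ⊎-small p q
      ; α⇒   = λ A B C → structural ((A + B) + C) (A + (B + C)) Sum.assocʳ
      ; α⇐   = λ A B C → structural (A + (B + C)) ((A + B) + C) Sum.assocˡ
      ; λ⇒   = λ A → structural (∅ + A) A [ ⊥-elim , id ]′
      ; λ⇐   = λ A → structural A (∅ + A) inj₂
      ; ρ⇒   = λ A → structural (A + ∅) A [ id , ⊥-elim ]′
      ; ρ⇐   = λ A → structural A (A + ∅) inj₁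
      ; σ    = λ A B → structural (A + B) (B + A) Sum.swap
      ; Tr   = λ _ (F , p) → trace F , Irrelevant.map (trace-small F) p
      }
      where
      Hom : SetBelow κ → SetBelow κ → Set (suc ℓ)
      Hom S T = [ F ∈ Triskell (value S) (value T) ∣ Edge F ≺ κ ]

      ∅ : SetBelow κ
      ∅ = ⊥ , Irrelevant.[ ⊥-small ]

      _+_ : SetBelow κ → SetBelow κ → SetBelow κ
      (A , p) + (B , q) = (A ⊎ B) , Irrelevant.zipWith ⊎-small p q

      structural : (A B : SetBelow κ) → (value A → value B) → Hom A B
      structural A B f = graph f , proof A

{-# OPTIONS --safe #-}

-- Excluded middle for all types is a global choice principle, so every set is
-- well-ordered, cardinals are comparable and M × M ↣ M for infinite M. Since κ is
-- uncountable, any two sets below κ inject into a common infinite M below κ, which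
-- absorbs sums, products and finite sequences; so Set_κ is closed under all the
-- operations. The axioms are bijections of edge sets: composing with the graph of a
-- bijection only renames sources or targets, which settles the coherence laws, and
-- the trace axioms regroup the edges of a path.
module Submission where

open import Defs
open import Algebra.Core using (Op₂)
open import Algebra.Structures using (IsMonoid)
open import Axiom.ExcludedMiddle using (ExcludedMiddle)
open import Axiom.Extensionality.Propositional using (Extensionality; implicit-extensionality)
open import Level using (Level; 0ℓ; Lift; lift; lower; _⊔_) renaming (suc to lsuc)
open import Data.Bool.Base using (Bool; true; false) renaming (T to Holds)
open import Data.Bool.Properties using (T-irrelevant)
open import Data.Empty using (⊥-elim)
import Data.Empty.Polymorphic as Poly
open import Data.List.Base using (List; []; _∷_; map)
open import Data.List.Properties using (map-injective; ∷-injective)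
open import Data.Maybe.Base using (Maybe; just; nothing)
open import Data.Maybe.Properties using (just-injective)
open import Data.Nat.Base using (ℕ; zero; suc)
open import Data.Nat.Properties using (suc-injective)
open import Data.Product.Base using (Σ-syntax; ∃-syntax; _×_; _,_; proj₁; proj₂)
open import Data.Product.Function.NonDependent.Propositional using (_×-↣_)
open import Data.Product.Relation.Binary.Lex.Strict using (×-Lex; ×-wellFounded)
open import Data.Refinement using (value)
open import Data.Sum.Base as Sum using (_⊎_; inj₁; inj₂; [_,_]′)
open import Data.Sum.Function.Propositional using (_⊎-↣_)
open import Data.Sum.Properties using (inj₁-injective; inj₂-injective)
open import Function.Base using (id; _∘_)
open import Function.Bundles using (_↣_; mk↣; mk↔ₛ′; Injection; Inverse)
open import Function.Construct.Composition using () renaming (_↣-∘_ to infixr 8 _∘↣_)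
open import Function.Construct.Identity using (↣-id)
open import Function.Definitions using (Injective)
open import Induction.WellFounded using (WellFounded; Acc; acc; module All; module FixPoint)
open import Relation.Binary.Construct.On using (wellFounded)
open import Relation.Binary.Core using (Rel)
open import Relation.Binary.Definitions using (Transitive)
open import Relation.Binary.PropositionalEquality.Core using (_≡_; _≢_; refl; sym; trans; cong; cong₂; subst)
open import Relation.Binary.PropositionalEquality.WithK using (≡-irrelevant)
open import Relation.Nullary.Decidable
  using (yes; no; isYes; toWitness; fromWitness; decidable-stable; recompute; recompute-constant)
open import Relation.Nullary.Negation using (¬_; contradiction)

-- Excluded middle is assumed for types, not only for propositions, so deciding a Σ-type hands over
-- a witness; the same decision turns a predicate of any level into a `Bool`-valued one. The first
-- gives choice functions, the second collects all stages of Zermelo's construction into a subset in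
-- the same universe. No ordinals are formed: comparisons are injections, and inductions run over
-- initial segments. For κ = ℵ₀ the claim would fail: one loop on U with an entry and an exit
-- already has infinitely many paths, one for each number of turns. On the categorical side the
-- obstacle is that edges of composites and paths carry equations between vertices. Uniqueness of
-- identity proofs makes these irrelevant, so a path is determined by its edges, and each trace
-- axiom becomes a recursive regrouping with two inverse laws. Such a recursion continues from the
-- middle of a path, at a vertex of the traced object; hence `Path` and the auxiliary lemmas allow
-- any start in X ⊎ U, although the trace itself only uses starts in X.

private
  variable
    a b i r : Level
    A B C : Set a

-- Well-orders and their initial segments

Connex : {A : Set a} → Rel A r → Set _
Connex _<_ = ∀ x y → x < y ⊎ x ≡ y ⊎ y < x

T-extensional : ∀ {b c} → (Holds b → Holds c) → (Holds c → Holds b) → b ≡ c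
T-extensional {true}  {true}  _ _ = refl
T-extensional {true}  {false} f _ = ⊥-elim (f _)
T-extensional {false} {true}  _ g = ⊥-elim (g _)
T-extensional {false} {false} _ _ = refl

-- The order lives at level 0 and is proof-irrelevant, so that `Below z` stays in the universe of
-- `A` and is a genuine subset of it. Induction over segments can then use a single predicate.
record WellOrder (A : Set a) : Set (lsuc 0ℓ ⊔ a) where
  infix 4 _<_
  field
    _<_          : Rel A 0ℓ
    connex       : Connex _<_
    <-trans      : Transitive _<_
    <-wf         : WellFounded _<_
    <-irrelevant : ∀ {x y} (p q : x < y) → p ≡ q

  Below : A → Set _
  Below z = Σ[ x ∈ A ] x < z

  below-≡ : ∀ {z} {x y : Below z} → proj₁ x ≡ proj₁ y → x ≡ y
  below-≡ refl = cong (_ ,_) (<-irrelevant _ _)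

  below↣ : ∀ z → Below z ↣ A
  below↣ z = mk↣ {to = proj₁} below-≡

  restrict : ∀ z → WellOrder (Below z)
  restrict z = record
    { _<_          = λ x y → proj₁ x < proj₁ y
    ; connex       = λ x y → connex-below (connex (proj₁ x) (proj₁ y))
    ; <-trans      = <-trans
    ; <-wf         = wellFounded proj₁ <-wf
    ; <-irrelevant = <-irrelevant
    }
    where
    connex-below : ∀ {x y : Below z} → proj₁ x < proj₁ y ⊎ proj₁ x ≡ proj₁ y ⊎ proj₁ y < proj₁ x →
                   proj₁ x < proj₁ y ⊎ x ≡ y ⊎ proj₁ y < proj₁ x
    connex-below (inj₁ x<y)        = inj₁ x<y
    connex-below (inj₂ (inj₁ x≡y)) = inj₂ (inj₁ (below-≡ x≡y))
    connex-below (inj₂ (inj₂ y<x)) = inj₂ (inj₂ y<x)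

-- Zermelo's well-ordering theorem

module Classical (em : ∀ {a} → ExcludedMiddle a) (ext : ∀ {a b} → Extensionality a b) where

  stable : {A : Set a} → ¬ ¬ A → A
  stable = decidable-stable em

  -- The stages are the subsets generated from ∅ by adjoining a chosen fresh
  -- element and taking unions. They are linearly ordered by inclusion, and
  -- each a is adjoined to exactly one stage, the largest one avoiding a.
  module Zermelo (A : Set a) where

    Subset : Set a
    Subset = A → Bool

    infix 4 _∈_ _⊆_

    _∈_ : A → Subset → Set
    x ∈ S = Holds (S x)

    _⊆_ : Subset → Subset → Set a
    S ⊆ R = ∀ x → x ∈ S → x ∈ R

    ⊆-antisym : ∀ {S R} → S ⊆ R → R ⊆ S → S ≡ R
    ⊆-antisym p q = ext λ x → T-extensional (p x) (q x)

    -- Comprehension for predicates of arbitrary level. Through it the predicate `Stage` itself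
    -- becomes a family to which `⋃` applies.
    ⟪_⟫ : {B : Set b} → (B → Set i) → B → Bool
    ⟪ P ⟫ x = isYes (em {P = P x})

    ⋃ : (Subset → Bool) → Subset
    ⋃ 𝓕 = ⟪ (λ x → ∃[ S ] Holds (𝓕 S) × x ∈ S) ⟫

    ⋃⁺ : ∀ {𝓕 S} → Holds (𝓕 S) → S ⊆ ⋃ 𝓕
    ⋃⁺ S∈𝓕 x x∈S = fromWitness (_ , S∈𝓕 , x∈S)

    -- A choice function: the witness depends on `S` alone, so equal subsets receive the same fresh
    -- element.
    pick : Subset → Maybe A
    pick S with em {P = ∃[ x ] ¬ x ∈ S}
    ... | yes (x , _) = just x
    ... | no  _       = nothing

    pick-fresh : ∀ S {x} → pick S ≡ just x → ¬ x ∈ S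
    pick-fresh S eq with em {P = ∃[ x ] ¬ x ∈ S}
    pick-fresh S refl | yes (_ , x∉S) = x∉S

    pick-proper : ∀ S {x} → ¬ x ∈ S → ∃[ y ] pick S ≡ just y
    pick-proper S x∉S with em {P = ∃[ x ] ¬ x ∈ S}
    ... | yes (y , _) = y , refl
    ... | no  full    = contradiction (_ , x∉S) full

    next : Subset → Subset
    next S = ⟪ (λ x → x ∈ S ⊎ pick S ≡ just x) ⟫

    ⊆-next : ∀ S → S ⊆ next S
    ⊆-next S x x∈S = fromWitness (inj₁ x∈S)

    next-⊆⇒full : ∀ {S} → next S ⊆ S → ∀ x → x ∈ S
    next-⊆⇒full {S} next⊆ x = stable λ x∉S →
      let (y , picked) = pick-proper S x∉S in
      pick-fresh S picked (next⊆ y (fromWitness (inj₂ picked)))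

    data Stage : Subset → Set a where
      step  : ∀ {S} → Stage S → Stage (next S)
      union : ∀ 𝓕 → (∀ S → Holds (𝓕 S) → Stage S) → Stage (⋃ 𝓕)

    union-stage : {P : Subset → Set i} → (∀ S → P S → Stage S) → Stage (⋃ ⟪ P ⟫)
    union-stage f = union _ λ S → f S ∘ toWitness

    -- Stronger than comparability: no stage lies properly between `R` and `next R`, which is what
    -- survives the successor case. `linear-next` is the same claim with the two stages exchanged;
    -- kept as a second function, it lets every call shrink one derivation and leave the other
    -- alone.
    linear : ∀ {S R} → Stage S → Stage R → S ⊆ R ⊎ next R ⊆ S
    linear-next : ∀ {S R} → Stage S → Stage R → next S ⊆ R ⊎ R ⊆ S

    linear {S} {R} (union 𝓕 st) ρ with em {P = ∃[ S′ ] Holds (𝓕 S′) × next R ⊆ S′}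
    ... | yes (S′ , S′∈𝓕 , p) = inj₂ λ x → ⋃⁺ S′∈𝓕 x ∘ p x
    ... | no  none = inj₁ λ x x∈S →
      let (S′ , S′∈𝓕 , x∈S′) = toWitness x∈S in
      [ (λ S′⊆R → S′⊆R x x∈S′) , (λ p → contradiction (S′ , S′∈𝓕 , p) none) ]′ (linear (st S′ S′∈𝓕) ρ)
    linear {_} {R} (step {S} σ) ρ with linear σ ρ
    ... | inj₂ p = inj₂ λ x → ⊆-next S x ∘ p x
    ... | inj₁ S⊆R with linear-next σ ρ
    ...   | inj₁ p   = inj₁ p
    ...   | inj₂ R⊆S = inj₂ (subst (λ Q → next R ⊆ next Q) (⊆-antisym R⊆S S⊆R) (λ _ → id))

    linear-next {S} σ (union 𝓕 st) with em {P = ∃[ R ] Holds (𝓕 R) × next S ⊆ R}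
    ... | yes (R , R∈𝓕 , p) = inj₁ λ x → ⋃⁺ R∈𝓕 x ∘ p x
    ... | no  none = inj₂ λ x x∈⋃ →
      let (R , R∈𝓕 , x∈R) = toWitness x∈⋃ in
      [ (λ p → contradiction (R , R∈𝓕 , p) none) , (λ R⊆S → R⊆S x x∈R) ]′ (linear-next σ (st R R∈𝓕))
    linear-next {S} σ (step {R} ρ) with linear-next σ ρ
    ... | inj₁ p = inj₁ λ x → ⊆-next R x ∘ p x
    ... | inj₂ R⊆S with linear σ ρ
    ...   | inj₂ p   = inj₂ p
    ...   | inj₁ S⊆R = inj₁ (subst (λ Q → next S ⊆ next Q) (⊆-antisym S⊆R R⊆S) (λ _ → id))

    before : A → Subset
    before x = ⋃ ⟪ (λ S → Stage S × ¬ x ∈ S) ⟫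

    before-stage : ∀ x → Stage (before x)
    before-stage x = union-stage λ _ → proj₁

    ∉-before : ∀ x → ¬ x ∈ before x
    ∉-before x x∈ = let (_ , S , x∈S) = toWitness x∈ in proj₂ (toWitness S) x∈S

    before-greatest : ∀ {x S} → Stage S → ¬ x ∈ S → S ⊆ before x
    before-greatest σ x∉S = ⋃⁺ (fromWitness (σ , x∉S))

    -- Otherwise `next (before x)` would be a stage avoiding `x`, hence inside `before x` by
    -- maximality. Then nothing is left to pick, so `before x` is everything and contains `x`.
    ∈-next-before : ∀ x → x ∈ next (before x)
    ∈-next-before x = stable λ x∉ →
      ∉-before x (next-⊆⇒full (before-greatest (step (before-stage x)) x∉) x)

    -- It recovers `x` from `before x`, so `before` is injective; the equality case of connexity
    -- rests on this.
    picked : ∀ x → pick (before x) ≡ just x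
    picked x with toWitness (∈-next-before x)
    ... | inj₁ x∈ = contradiction x∈ (∉-before x)
    ... | inj₂ eq = eq

    infix 4 _≺ᶻ_

    _≺ᶻ_ : Rel A 0ℓ
    x ≺ᶻ y = x ∈ before y

    ≺ᶻ-connex : Connex _≺ᶻ_
    ≺ᶻ-connex x y with linear (before-stage x) (before-stage y) | linear (before-stage y) (before-stage x)
    ... | inj₂ p | _      = inj₂ (inj₂ (p y (∈-next-before y)))
    ... | inj₁ _ | inj₂ q = inj₁ (q x (∈-next-before x))
    ... | inj₁ p | inj₁ q = inj₂ (inj₁ (just-injective
      (trans (sym (picked x)) (trans (cong pick (⊆-antisym p q)) (picked y)))))

    ≺ᶻ-trans : Transitive _≺ᶻ_
    ≺ᶻ-trans {x} {y} {z} x≺y y≺z with linear (before-stage y) (before-stage z)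
    ... | inj₁ p = p x x≺y
    ... | inj₂ p = contradiction (p y (⊆-next (before z) y y≺z)) (∉-before y)

    -- By induction on the generation of the stage. For a newly adjoined `x`, either `before x` lies
    -- in the previous stage, whose elements are accessible, or it contains `next S` and thus `x`
    -- itself, which is absurd.
    stage-acc : ∀ {S} → Stage S → ∀ x → x ∈ S → Acc _≺ᶻ_ x
    stage-acc (union 𝓕 st) x x∈⋃ =
      let (S , S∈𝓕 , x∈S) = toWitness x∈⋃ in stage-acc (st S S∈𝓕) x x∈S
    stage-acc (step {S} σ) x x∈next with toWitness x∈next | linear (before-stage x) σ
    ... | inj₁ x∈S | _      = stage-acc σ x x∈S
    ... | inj₂ _   | inj₁ p = acc λ {y} y≺x → stage-acc σ y (p y y≺x)
    ... | inj₂ _   | inj₂ p = contradiction (p x x∈next) (∉-before x)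

    ≺ᶻ-wf : WellFounded _≺ᶻ_
    -- The union of all stages is a stage, so its successor is among the sets united: it is closed
    -- under `next` and therefore all of `A`.
    ≺ᶻ-wf x = stage-acc stages x (next-⊆⇒full (⋃⁺ (fromWitness (step stages))) x)
      where
      stages : Stage (⋃ ⟪ Stage ⟫)
      stages = union-stage λ _ → id

    wellOrder : WellOrder A
    wellOrder = record
      { _<_          = _≺ᶻ_
      ; connex       = ≺ᶻ-connex
      ; <-trans      = ≺ᶻ-trans
      ; <-wf         = ≺ᶻ-wf
      ; <-irrelevant = T-irrelevant
      }

  -- Comparability of cardinals

  -- Map I to B by well-founded recursion, sending each index to a fresh element
  -- of B; when B is exhausted at i, it injects into the segment below i.
  greedy : {I : Set i} {_<_ : Rel I r} → WellFounded _<_ → Connex _<_ → (B : Set b) →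
           (I ↣ B) ⊎ (∃[ i ] Σ[ h ∈ B ↣ I ] ∀ x → Injection.to h x < i)
  greedy {I = I} {_<_} wf connex B with em {P = ∃[ i ] Σ[ h ∈ B ↣ I ] ∀ x → Injection.to h x < i}
  ... | yes stuck = inj₂ stuck
  ... | no ¬stuck = inj₁ (mk↣ {to = f} f-injective)
    where
    -- Making the values independent of the proofs of j < i.
    at : ∀ {i j} → (∀ {j} → j < i → B) → j < i → B
    at earlier j<i = earlier (recompute em j<i)

    -- If no element were fresh, every `x` would be the value of some earlier index; choosing such
    -- an index injects `B` into the segment below `i`, the case already excluded.
    fresh : ∀ i (earlier : ∀ {j} → j < i → B) → Σ[ x ∈ B ] (∀ j (j<i : j < i) → at earlier j<i ≢ x)
    fresh i earlier = stable λ none →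
      let used : ∀ x → ∃[ j ] Σ[ j<i ∈ j < i ] at earlier j<i ≡ x
          used x = stable λ unused → none (x , λ _ j<i eq → unused (_ , j<i , eq))
      in ¬stuck (i , mk↣ {to = proj₁ ∘ used} (λ {x} {y} → same (used x) (used y)) , λ x → proj₁ (proj₂ (used x)))
      where
      same : ∀ {x y} (u : ∃[ j ] Σ[ j<i ∈ j < i ] at earlier j<i ≡ x)
             (v : ∃[ j ] Σ[ j<i ∈ j < i ] at earlier j<i ≡ y) → proj₁ u ≡ proj₁ v → x ≡ y
      same (_ , p , refl) (_ , q , refl) refl = cong earlier (recompute-constant em p q)

    next : ∀ i → (∀ {j} → j < i → B) → B
    next i earlier = proj₁ (fresh i earlier)

    open All wf _ using (wfRec)
    f : I → B
    f = wfRec (λ _ → B) next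

    f-unfold : ∀ {i} → f i ≡ next i (λ {j} _ → f j)
    f-unfold = FixPoint.unfold-wfRec wf (λ _ → B) next
      λ i eq → cong (next i) (implicit-extensionality ext (ext eq))

    f-fresh : ∀ {i j} → j < i → f j ≢ f i
    f-fresh {i} j<i eq = proj₂ (fresh i (λ {j} _ → f j)) _ j<i (trans eq f-unfold)

    f-injective : Injective _≡_ _≡_ f
    f-injective {x} {y} eq with connex x y
    ... | inj₁ x<y        = contradiction eq (f-fresh x<y)
    ... | inj₂ (inj₁ x≡y) = x≡y
    ... | inj₂ (inj₂ y<x) = contradiction (sym eq) (f-fresh y<x)

  -- Only `A` needs a well-order: `greedy` either places all of `A` in `B` or uses `B` up inside
  -- `A`.
  comparable : (A : Set a) (B : Set b) → A ↣ B ⊎ B ↣ A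
  comparable A B with greedy <-wf connex B
    where open WellOrder (Zermelo.wellOrder A)
  ... | inj₁ A↣B           = inj₁ A↣B
  ... | inj₂ (_ , B↣A , _) = inj₂ B↣A

  -- Hessenberg's theorem on squares of infinite sets

  Infinite : Set a → Set a
  Infinite X = ℕ ↣ X

  ⊎↣× : Infinite A → (A ⊎ A) ↣ (A × A)
  ⊎↣× {A = A} ι = mk↣ {to = code} code-injective
    where
    open Injection ι using (to; injective)
    code : A ⊎ A → A × A
    code (inj₁ x) = to 0 , x
    code (inj₂ x) = to 1 , x
    code-injective : Injective _≡_ _≡_ code
    code-injective {inj₁ _} {inj₁ _} eq = cong inj₁ (cong proj₂ eq)
    code-injective {inj₁ _} {inj₂ _} eq with () ← injective (cong proj₁ eq)
    code-injective {inj₂ _} {inj₁ _} eq with () ← injective (cong proj₁ eq)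
    code-injective {inj₂ _} {inj₂ _} eq = cong inj₂ (cong proj₂ eq)

  -- Infinity is a premise inside the predicate so that the induction over segments can also pass
  -- through the finite ones.
  Square : Set a → Set a
  Square X = Infinite X → (X × X) ↣ X

  Square-resp-↣ : A ↣ B → B ↣ A → Square A → Square B
  Square-resp-↣ A↣B B↣A □ ι = A↣B ∘↣ □ (B↣A ∘↣ ι) ∘↣ (B↣A ×-↣ B↣A)

  ℕ×ℕ↣ℕ : (ℕ × ℕ) ↣ ℕ
  ℕ×ℕ↣ℕ = mk↣ {to = λ (m , n) → pair m n} (pair-injective _ _)
    where
    double : ℕ → ℕ
    double zero    = zero
    double (suc n) = suc (suc (double n))
    double-injective : ∀ m n → double m ≡ double n → m ≡ n
    double-injective zero    zero    _  = refl
    double-injective (suc m) (suc n) eq = cong suc (double-injective m n (suc-injective (suc-injective eq)))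
    double≢suc-double : ∀ m n → double m ≢ suc (double n)
    double≢suc-double (suc m) n eq = double≢suc-double n m (sym (suc-injective eq))
    -- pair m n = 2ᵐ (2n + 1)
    pair : ℕ → ℕ → ℕ
    pair zero    n = suc (double n)
    pair (suc m) n = double (pair m n)
    pair-injective : ∀ p q → pair (proj₁ p) (proj₂ p) ≡ pair (proj₁ q) (proj₂ q) → p ≡ q
    pair-injective (zero , n)  (zero , n′)   eq = cong (zero ,_) (double-injective _ _ (suc-injective eq))
    pair-injective (zero , n)  (suc m′ , n′) eq = contradiction (sym eq) (double≢suc-double (pair m′ n′) n)
    pair-injective (suc m , n) (zero , n′)   eq = contradiction eq (double≢suc-double (pair m n) n′)
    pair-injective (suc m , n) (suc m′ , n′) eq
      with refl ← pair-injective (m , n) (m′ , n′) (double-injective _ _ eq) = refl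

  -- Order A × A by the maximum of the coordinates, so that every segment lies in
  -- a square {x ≤ m}²; then run greedy with values in A.
  module Hessenberg {A : Set a} (W : WellOrder A) where
    open WellOrder W

    UpTo : A → Set _
    UpTo m = Σ[ x ∈ A ] (x < m ⊎ x ≡ m)

    max : ∀ x y → Σ[ m ∈ A ] (x < m ⊎ x ≡ m) × (y < m ⊎ y ≡ m)
    max x y with connex x y
    ... | inj₁ x<y        = y , inj₁ x<y , inj₂ refl
    ... | inj₂ (inj₁ x≡y) = y , inj₂ x≡y , inj₂ refl
    ... | inj₂ (inj₂ y<x) = x , inj₂ refl , inj₁ y<x

    weaken : ∀ {x m n} → x < m ⊎ x ≡ m → m < n ⊎ m ≡ n → x < n ⊎ x ≡ n
    weaken (inj₁ x<m)  (inj₁ m<n)  = inj₁ (<-trans x<m m<n)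
    weaken (inj₁ x<m)  (inj₂ refl) = inj₁ x<m
    weaken (inj₂ refl) q           = q

    key : A × A → A × (A × A)
    key p = proj₁ (max (proj₁ p) (proj₂ p)) , p

    -- An arbitrary well-order of the pairs breaks ties between equal maxima: only the bound on the
    -- maximum is ever extracted from `⊏`.
    module Pairs = WellOrder (Zermelo.wellOrder (A × A))

    infix 4 _⊏_
    _⊏_ : Rel (A × A) _
    p ⊏ q = ×-Lex _≡_ _<_ Pairs._<_ (key p) (key q)

    ⊏-wf : WellFounded _⊏_
    ⊏-wf = wellFounded key (×-wellFounded <-wf Pairs.<-wf)

    ⊏-connex : Connex _⊏_
    ⊏-connex p q with connex (proj₁ (key p)) (proj₁ (key q)) | Pairs.connex p q
    ... | inj₁ m<n        | _               = inj₁ (inj₁ m<n)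
    ... | inj₂ (inj₂ n<m) | _               = inj₂ (inj₂ (inj₁ n<m))
    ... | inj₂ (inj₁ m≡n) | inj₁ p<q        = inj₁ (inj₂ (m≡n , p<q))
    ... | inj₂ (inj₁ m≡n) | inj₂ (inj₁ p≡q) = inj₂ (inj₁ p≡q)
    ... | inj₂ (inj₁ m≡n) | inj₂ (inj₂ q<p) = inj₂ (inj₂ (inj₂ (sym m≡n , q<p)))

    ⊏⇒≤max : ∀ {p q} → p ⊏ q → proj₁ (key p) < proj₁ (key q) ⊎ proj₁ (key p) ≡ proj₁ (key q)
    ⊏⇒≤max (inj₁ m<n)       = inj₁ m<n
    ⊏⇒≤max (inj₂ (m≡n , _)) = inj₂ m≡n

    ⊏⇒UpTo² : ∀ {q} p → p ⊏ q → UpTo (proj₁ (key q)) × UpTo (proj₁ (key q))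
    ⊏⇒UpTo² (x , y) p⊏q =
      let (_ , x≤ , y≤) = max x y in
      (x , weaken x≤ (⊏⇒≤max p⊏q)) , (y , weaken y≤ (⊏⇒≤max p⊏q))

    UpTo↣ : ∀ {Y : Set b} m → Below m ↣ Y → Infinite Y → UpTo m ↣ (Y ⊎ Y)
    UpTo↣ {Y = Y} m below↣Y ι = mk↣ {to = code} code-injective
      where
      module B = Injection below↣Y
      code : UpTo m → Y ⊎ Y
      code (x , inj₁ x<m) = inj₁ (B.to (x , x<m))
      code (x , inj₂ _)   = inj₂ (Injection.to ι 0)
      code-injective : Injective _≡_ _≡_ code
      code-injective {_ , inj₁ _} {_ , inj₁ _} eq
        with refl ← B.injective (inj₁-injective eq) = refl
      code-injective {_ , inj₂ refl} {_ , inj₂ refl} _ = refl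

    -- If values run out at a pair with maximum m, then A injects into {x ≤ m}², hence
    -- into any infinite Y ⊇ Below m with Y × Y ↣ Y: Below m itself, or ℕ.
    square : (∀ z → Square (Below z)) → Square A
    square below-square ι with greedy ⊏-wf ⊏-connex A
    ... | inj₁ A×A↣A = A×A↣A
    ... | inj₂ (q , h , h⊏q) = [ (λ ℕ↣below → bounded ℕ↣below (below-square m ℕ↣below) (↣-id _) (below↣ m))
                               , (λ below↣ℕ → bounded (↣-id ℕ) ℕ×ℕ↣ℕ below↣ℕ ι) ]′ (comparable ℕ (Below m))
      where
      m : A
      m = proj₁ (key q)

      A↣UpTo² : A ↣ (UpTo m × UpTo m)
      A↣UpTo² = mk↣ {to = λ x → ⊏⇒UpTo² (Injection.to h x) (h⊏q x)} λ eq →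
        Injection.injective h (cong₂ _,_ (cong (proj₁ ∘ proj₁) eq) (cong (proj₁ ∘ proj₂) eq))

      -- `A` and `Y` inject into each other, so `Y × Y ↣ Y` carries over to `A`. The level of `Y` is
      -- free because `Y` is either `Below m` or `ℕ`.
      bounded : {Y : Set b} → Infinite Y → (Y × Y) ↣ Y → Below m ↣ Y → Y ↣ A → (A × A) ↣ A
      bounded {Y = Y} Y-infinite Y×Y↣Y below↣Y Y↣A = Y↣A ∘↣ Y×Y↣Y ∘↣ (A↣Y ×-↣ A↣Y)
        where
        UpTo↣Y : UpTo m ↣ Y
        UpTo↣Y = Y×Y↣Y ∘↣ ⊎↣× Y-infinite ∘↣ UpTo↣ m below↣Y Y-infinite
        A↣Y : A ↣ Y
        A↣Y = Y×Y↣Y ∘↣ (UpTo↣Y ×-↣ UpTo↣Y) ∘↣ A↣UpTo²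

  -- Well-founded induction on `z`. A segment of `restrict z` is, up to mutual injections, a segment
  -- of the whole order, so the induction hypothesis is what `Hessenberg.square` asks of `Below z`.
  square-below : {A : Set a} (W : WellOrder A) → ∀ z → Square (WellOrder.Below W z)
  square-below {A = A} W = wfRec (Square ∘ Below) λ z rec →
    Hessenberg.square (restrict z) λ (y , y<z) →
      Square-resp-↣
        (mk↣ {to = λ (x , x<y) → (x , <-trans x<y y<z) , x<y} λ eq → below-≡ (cong (proj₁ ∘ proj₁) eq))
        (mk↣ {to = λ ((x , _) , x<y) → x , x<y} λ eq →
          WellOrder.below-≡ (restrict z) {y , y<z} (below-≡ (cong proj₁ eq)))
        (rec y<z)
    where
    open WellOrder W
    open All <-wf _ using (wfRec)

  square : {A : Set a} → Square A
  square {A = A} = Hessenberg.square W (square-below W)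
    where
    W : WellOrder A
    W = Zermelo.wellOrder A

  -- Sums, products and finite sequences below κ

  ⊎-absorb : Infinite A → (A ⊎ A) ↣ A
  ⊎-absorb ι = square ι ∘↣ ⊎↣× ι

  -- The length in the code tells how many pairings to undo, so the arbitrary element standing for
  -- `[]` is never mistaken for an entry.
  List↣ : Infinite A → (A × A) ↣ A → List A ↣ A
  List↣ {A = A} ι □ = □ ∘↣ (ι ×-↣ ↣-id A) ∘↣ mk↣ {to = code} code-injective
    where
    open Injection □ using (to; injective)
    code : List A → ℕ × A
    code []       = 0 , Injection.to ι 0
    code (x ∷ xs) = suc (proj₁ (code xs)) , to (x , proj₂ (code xs))
    code-injective : Injective _≡_ _≡_ code
    code-injective {[]}    {[]}    _ = refl
    code-injective {_ ∷ _} {_ ∷ _} eq with injective (cong proj₂ eq)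
    ... | eq′ = cong₂ _∷_ (cong proj₁ eq′)
      (code-injective (cong₂ _,_ (suc-injective (cong proj₁ eq)) (cong proj₂ eq′)))

  ≺-downward : A ↣ B → B ≺ C → A ≺ C
  ≺-downward A↣B (B↣C , C↣̸B) = B↣C ∘↣ A↣B , λ C↣A → C↣̸B (A↣B ∘↣ C↣A)

  larger : {A B : Set a} → A ≺ C → B ≺ C → Σ[ M ∈ Set a ] A ↣ M × B ↣ M × M ≺ C
  larger {A = A} {B = B} A≺C B≺C with comparable A B
  ... | inj₁ A↣B = B , A↣B , ↣-id B , B≺C
  ... | inj₂ B↣A = A , ↣-id A , B↣A , A≺C

  module Small {κ : Set a} (κ≥ℵ₁ : κ ≥ℵ₁) where

    Lift↣ : Lift a ℕ ↣ ℕ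
    Lift↣ = mk↣ {to = lower} (cong lift)

    infinite-bound : {A : Set a} → A ≺ κ → Σ[ M ∈ Set a ] Infinite M × A ↣ M × M ≺ κ
    infinite-bound A≺κ =
      let (M , ℕ↣M , A↣M , M≺κ) = larger (≺-downward Lift↣ κ≥ℵ₁) A≺κ
      in M , ℕ↣M ∘↣ mk↣ {to = lift} (cong lower) , A↣M , M≺κ

    common-bound : {A B : Set a} → A ≺ κ → B ≺ κ → Σ[ M ∈ Set a ] Infinite M × A ↣ M × B ↣ M × M ≺ κ
    common-bound A≺κ B≺κ =
      let (_ , A↣L , B↣L , L≺κ) = larger A≺κ B≺κ
          (M , ι , L↣M , M≺κ)   = infinite-bound L≺κ
      in M , ι , L↣M ∘↣ A↣L , L↣M ∘↣ B↣L , M≺κ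

    ⊎-≺ : {A B : Set a} → A ≺ κ → B ≺ κ → (A ⊎ B) ≺ κ
    ⊎-≺ A≺κ B≺κ =
      let (_ , ι , A↣M , B↣M , M≺κ) = common-bound A≺κ B≺κ
      in ≺-downward (⊎-absorb ι ∘↣ (A↣M ⊎-↣ B↣M)) M≺κ

    ×-≺ : {A B : Set a} → A ≺ κ → B ≺ κ → (A × B) ≺ κ
    ×-≺ A≺κ B≺κ =
      let (_ , ι , A↣M , B↣M , M≺κ) = common-bound A≺κ B≺κ
      in ≺-downward (square ι ∘↣ (A↣M ×-↣ B↣M)) M≺κ

    List-≺ : {A : Set a} → A ≺ κ → List A ≺ κ
    List-≺ A≺κ =
      let (_ , ι , A↣M , M≺κ) = infinite-bound A≺κ
      in ≺-downward (List↣ ι (square ι) ∘↣ mk↣ {to = map (Injection.to A↣M)} (map-injective (Injection.injective A↣M))) M≺κ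

-- Isomorphism and composition of triskells

module TriskellProperties {ℓ} {Ω : Set ℓ} (_·_ : Op₂ Ω) (ε : Ω) (isMonoid : IsMonoid _≡_ _·_ ε) where
  open Triskells _·_ ε
  open IsMonoid isMonoid using () renaming (assoc to ·-assoc; identityˡ to ·-identityˡ; identityʳ to ·-identityʳ)

  private
    variable
      S S′ S″ T T′ T″ W Z X X′ Y Y′ U V : Set ℓ
      F G H F′ G′ : Triskell S T

  module ≅ {S T} {F G : Triskell S T} (i : F ≅ G) where
    open _≅_ i public
    to-from : ∀ e → to (from e) ≡ e
    to-from = Inverse.strictlyInverseˡ edges
    from-to : ∀ e → from (to e) ≡ e
    from-to = Inverse.strictlyInverseʳ edges

  ≅-refl : F ≅ F
  ≅-refl = record
    { edges     = mk↔ₛ′ id id (λ _ → refl) (λ _ → refl)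
    ; source-to = λ _ → refl
    ; target-to = λ _ → refl
    ; weight-to = λ _ → refl
    }

  ≅-sym : F ≅ G → G ≅ F
  ≅-sym {F = F} {G} i = record
    { edges     = mk↔ₛ′ from to from-to to-from
    ; source-to = λ e → trans (sym (source-to (from e))) (cong (source G) (to-from e))
    ; target-to = λ e → trans (sym (target-to (from e))) (cong (target G) (to-from e))
    ; weight-to = λ e → trans (sym (weight-to (from e))) (cong (weight G) (to-from e))
    }
    where open ≅ i

  ≅-trans : F ≅ G → G ≅ H → F ≅ H
  ≅-trans i j = record
    { edges     = mk↔ₛ′ (J.to ∘ I.to) (I.from ∘ J.from)
                    (λ e → trans (cong J.to (I.to-from _)) (J.to-from e))
                    (λ e → trans (cong I.from (J.from-to _)) (I.from-to e))
    ; source-to = λ e → trans (J.source-to _) (I.source-to e)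
    ; target-to = λ e → trans (J.target-to _) (I.target-to e)
    ; weight-to = λ e → trans (J.weight-to _) (I.weight-to e)
    }
    where
    module I = ≅ i
    module J = ≅ j

  infixr 2 _∙_
  _∙_ : F ≅ G → G ≅ H → F ≅ H
  _∙_ = ≅-trans

  -- The matching condition carries no data, so the pullback is a subset of the product. Both the
  -- isomorphisms and the size bound for composites use this.
  equaliser-≡ : {A : Set ℓ} {f g : A → S} {x y : Σ[ x ∈ A ] f x ≡ g x} → proj₁ x ≡ proj₁ y → x ≡ y
  equaliser-≡ {x = x , p} {_ , q} refl = cong (x ,_) (≡-irrelevant p q)

  compose-cong : F ≅ F′ → G ≅ G′ → compose F G ≅ compose F′ G′
  compose-cong i j = record
    { edges     = mk↔ₛ′
        (λ ((e , e′) , p) → (I.to e , J.to e′) ,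
          trans (I.target-to e) (trans p (sym (J.source-to e′))))
        (λ ((e , e′) , p) → (I.from e , J.from e′) ,
          trans (I⁻¹.target-to e) (trans p (sym (J⁻¹.source-to e′))))
        (λ ((e , e′) , _) → equaliser-≡ (cong₂ _,_ (I.to-from e) (J.to-from e′)))
        (λ ((e , e′) , _) → equaliser-≡ (cong₂ _,_ (I.from-to e) (J.from-to e′)))
    ; source-to = λ ((e , _) , _) → I.source-to e
    ; target-to = λ ((_ , e′) , _) → J.target-to e′
    ; weight-to = λ ((e , e′) , _) → cong₂ _·_ (I.weight-to e) (J.weight-to e′)
    }
    where
    module I = ≅ i
    module J = ≅ j
    module I⁻¹ = ≅ (≅-sym i)
    module J⁻¹ = ≅ (≅-sym j)

  compose-assoc : (F : Triskell S T) (G : Triskell T T′) (H : Triskell T′ T″) →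
                  compose (compose F G) H ≅ compose F (compose G H)
  compose-assoc F G H = record
    { edges     = mk↔ₛ′
        (λ ((((e , e′) , p) , e″) , q) → (e , ((e′ , e″) , q)) , p)
        (λ ((e , ((e′ , e″) , q)) , p) → (((e , e′) , p) , e″) , q)
        (λ _ → refl) (λ _ → refl)
    ; source-to = λ _ → refl
    ; target-to = λ _ → refl
    ; weight-to = λ ((((e , e′) , _) , e″) , _) → sym (·-assoc (weight F e) (weight G e′) (weight H e″))
    }

  -- Graphs of maps act by relabelling

  relabel : (S → S′) → (T → T′) → Triskell S T → Triskell S′ T′
  relabel f g F = record
    { Edge = Edge F ; source = f ∘ source F ; target = g ∘ target F ; weight = weight F }

  relabel-cong : (f : S → S′) (g : T → T′) → F ≅ G → relabel f g F ≅ relabel f g G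
  relabel-cong f g i = record
    { edges     = I.edges
    ; source-to = cong f ∘ I.source-to
    ; target-to = cong g ∘ I.target-to
    ; weight-to = I.weight-to
    }
    where module I = ≅ i

  compose-graphʳ : (F : Triskell S T) (g : T → T′) → compose F (graph g) ≅ relabel id g F
  compose-graphʳ F g = record
    { edges     = mk↔ₛ′ (λ ((e , _) , _) → e) (λ e → (e , target F e) , refl)
                    (λ _ → refl) (λ { ((_ , _) , refl) → refl })
    ; source-to = λ _ → refl
    ; target-to = λ { ((_ , _) , refl) → refl }
    ; weight-to = λ ((e , _) , _) → sym (·-identityʳ (weight F e))
    }

  -- Unlike composition on the right, this needs an inverse: an edge of `F` extends once for each
  -- preimage of its source, so there must be exactly one.
  compose-graphˡ : (f : S → T) (f⁻¹ : T → S) → (∀ t → f (f⁻¹ t) ≡ t) → (∀ s → f⁻¹ (f s) ≡ s) →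
                   (F : Triskell T T′) → compose (graph f) F ≅ relabel f⁻¹ id F
  compose-graphˡ f f⁻¹ f-f⁻¹ f⁻¹-f F = record
    { edges     = mk↔ₛ′ (λ ((_ , e) , _) → e) (λ e → (f⁻¹ (source F e) , e) , f-f⁻¹ _)
                    (λ _ → refl)
                    (λ ((s , e) , p) → equaliser-≡ (cong (_, e) (trans (cong f⁻¹ (sym p)) (f⁻¹-f s))))
    ; source-to = λ ((s , e) , p) → trans (cong f⁻¹ (sym p)) (f⁻¹-f s)
    ; target-to = λ _ → refl
    ; weight-to = λ ((_ , e) , _) → sym (·-identityˡ (weight F e))
    }

  identityˡ : (F : Triskell S T) → compose (graph id) F ≅ F
  identityˡ = compose-graphˡ id id (λ _ → refl) (λ _ → refl)

  identityʳ : (F : Triskell S T) → compose F (graph id) ≅ F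
  identityʳ F = compose-graphʳ F id

  -- The form in which unitors and associators surround a morphism in the vanishing and superposing
  -- axioms.
  conjugate : (f : S → S′) (f⁻¹ : S′ → S) → (∀ s → f (f⁻¹ s) ≡ s) → (∀ s → f⁻¹ (f s) ≡ s) →
              (F : Triskell S′ T′) (g : T′ → T) →
              compose (compose (graph f) F) (graph g) ≅ relabel f⁻¹ g F
  conjugate f f⁻¹ p q F g = compose-graphʳ _ g ∙ relabel-cong id g (compose-graphˡ f f⁻¹ p q F)

  assocˡ-assocʳ : ∀ (s : (S ⊎ T) ⊎ U) → Sum.assocˡ (Sum.assocʳ s) ≡ s
  assocˡ-assocʳ (inj₁ (inj₁ _)) = refl
  assocˡ-assocʳ (inj₁ (inj₂ _)) = refl
  assocˡ-assocʳ (inj₂ _)        = refl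

  assocʳ-assocˡ : ∀ (s : S ⊎ (T ⊎ U)) → Sum.assocʳ (Sum.assocˡ s) ≡ s
  assocʳ-assocˡ (inj₁ _)        = refl
  assocʳ-assocˡ (inj₂ (inj₁ _)) = refl
  assocʳ-assocˡ (inj₂ (inj₂ _)) = refl

  conjugate-assoc : (F : Triskell (S ⊎ (T ⊎ U)) (S′ ⊎ (T′ ⊎ V))) →
                    compose (compose (graph Sum.assocʳ) F) (graph Sum.assocˡ) ≅ relabel Sum.assocˡ Sum.assocˡ F
  conjugate-assoc F = conjugate Sum.assocʳ Sum.assocˡ assocʳ-assocˡ assocˡ-assocʳ F Sum.assocˡ

  graph-cong : {f g : S → T} → (∀ s → f s ≡ g s) → graph f ≅ graph g
  graph-cong f≗g = record
    { edges     = mk↔ₛ′ id id (λ _ → refl) (λ _ → refl)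
    ; source-to = λ _ → refl
    ; target-to = sym ∘ f≗g
    ; weight-to = λ _ → refl
    }

  graph-⊕ : (f : S → T) (g : S′ → T′) → graph f ⊕ graph g ≅ graph (Sum.map f g)
  graph-⊕ f g = record
    { edges     = mk↔ₛ′ id id (λ _ → refl) (λ _ → refl)
    ; source-to = λ { (inj₁ _) → refl ; (inj₂ _) → refl }
    ; target-to = λ { (inj₁ _) → refl ; (inj₂ _) → refl }
    ; weight-to = λ { (inj₁ _) → refl ; (inj₂ _) → refl }
    }

  graph-∘ : (f : S → T) (g : T → T′) → compose (graph f) (graph g) ≅ graph (g ∘ f)
  graph-∘ f g = compose-graphʳ (graph f) g

  graph-inverse : (f : S → T) (g : T → S) → (∀ s → g (f s) ≡ s) → compose (graph f) (graph g) ≅ graph id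
  graph-inverse f g g-f = graph-∘ f g ∙ graph-cong g-f

  -- The symmetric monoidal structure

  ⊕-cong : F ≅ F′ → G ≅ G′ → F ⊕ G ≅ F′ ⊕ G′
  ⊕-cong i j = record
    { edges     = mk↔ₛ′ (Sum.map I.to J.to) (Sum.map I.from J.from)
        (λ { (inj₁ e) → cong inj₁ (I.to-from e) ; (inj₂ e) → cong inj₂ (J.to-from e) })
        (λ { (inj₁ e) → cong inj₁ (I.from-to e) ; (inj₂ e) → cong inj₂ (J.from-to e) })
    ; source-to = λ { (inj₁ e) → cong inj₁ (I.source-to e) ; (inj₂ e) → cong inj₂ (J.source-to e) }
    ; target-to = λ { (inj₁ e) → cong inj₁ (I.target-to e) ; (inj₂ e) → cong inj₂ (J.target-to e) }
    ; weight-to = λ { (inj₁ e) → I.weight-to e ; (inj₂ e) → J.weight-to e }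
    }
    where
    module I = ≅ i
    module J = ≅ j

  ⊕-id : graph {S} id ⊕ graph {T} id ≅ graph id
  ⊕-id = graph-⊕ id id ∙ graph-cong λ { (inj₁ _) → refl ; (inj₂ _) → refl }

  ⊕-compose : (F : Triskell S T) (G : Triskell T T′) (F′ : Triskell S′ S″) (G′ : Triskell S″ T″) →
              compose F G ⊕ compose F′ G′ ≅ compose (F ⊕ F′) (G ⊕ G′)
  ⊕-compose F G F′ G′ = record
    { edges     = mk↔ₛ′ to from
        (λ { ((inj₁ _ , inj₁ _) , _) → equaliser-≡ refl ; ((inj₂ _ , inj₂ _) , _) → equaliser-≡ refl })
        (λ { (inj₁ _) → cong inj₁ (equaliser-≡ refl) ; (inj₂ _) → cong inj₂ (equaliser-≡ refl) })
    ; source-to = λ { (inj₁ _) → refl ; (inj₂ _) → refl }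
    ; target-to = λ { (inj₁ _) → refl ; (inj₂ _) → refl }
    ; weight-to = λ { (inj₁ _) → refl ; (inj₂ _) → refl }
    }
    where
    to : Edge (compose F G ⊕ compose F′ G′) → Edge (compose (F ⊕ F′) (G ⊕ G′))
    to (inj₁ ((e , e′) , p)) = (inj₁ e , inj₁ e′) , cong inj₁ p
    to (inj₂ ((e , e′) , p)) = (inj₂ e , inj₂ e′) , cong inj₂ p
    from : Edge (compose (F ⊕ F′) (G ⊕ G′)) → Edge (compose F G ⊕ compose F′ G′)
    from ((inj₁ e , inj₁ e′) , p) = inj₁ ((e , e′) , inj₁-injective p)
    from ((inj₂ e , inj₂ e′) , p) = inj₂ ((e , e′) , inj₂-injective p)

  swap-swap : ∀ (s : S ⊎ T) → Sum.swap (Sum.swap s) ≡ s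
  swap-swap (inj₁ _) = refl
  swap-swap (inj₂ _) = refl

  private
    ⊥ : Set ℓ
    ⊥ = Poly.⊥

  unitˡ : ⊥ ⊎ S → S
  unitˡ = [ Poly.⊥-elim , id ]′

  unitʳ : S ⊎ ⊥ → S
  unitʳ = [ id , Poly.⊥-elim ]′

  inj₂-unitˡ : ∀ (s : ⊥ ⊎ S) → inj₂ (unitˡ s) ≡ s
  inj₂-unitˡ (inj₂ _) = refl

  inj₁-unitʳ : ∀ (s : S ⊎ ⊥) → inj₁ (unitʳ s) ≡ s
  inj₁-unitʳ (inj₁ _) = refl

  assoc-natural : (F : Triskell S S′) (G : Triskell T T′) (H : Triskell U V) →
                  compose ((F ⊕ G) ⊕ H) (graph Sum.assocʳ) ≅ compose (graph Sum.assocʳ) (F ⊕ (G ⊕ H))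
  assoc-natural F G H = compose-graphʳ _ _ ∙ reassociate ∙ ≅-sym (compose-graphˡ _ Sum.assocˡ assocʳ-assocˡ assocˡ-assocʳ _)
    where
    reassociate : relabel id Sum.assocʳ ((F ⊕ G) ⊕ H) ≅ relabel Sum.assocˡ id (F ⊕ (G ⊕ H))
    reassociate = record
      { edges     = mk↔ₛ′ Sum.assocʳ Sum.assocˡ assocʳ-assocˡ assocˡ-assocʳ
      ; source-to = λ { (inj₁ (inj₁ _)) → refl ; (inj₁ (inj₂ _)) → refl ; (inj₂ _) → refl }
      ; target-to = λ { (inj₁ (inj₁ _)) → refl ; (inj₁ (inj₂ _)) → refl ; (inj₂ _) → refl }
      ; weight-to = λ { (inj₁ (inj₁ _)) → refl ; (inj₁ (inj₂ _)) → refl ; (inj₂ _) → refl }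
      }

  unitˡ-natural : (F : Triskell S T) →
                  compose (graph {⊥} id ⊕ F) (graph unitˡ) ≅ compose (graph unitˡ) F
  unitˡ-natural F = compose-graphʳ _ _ ∙ forget ∙ ≅-sym (compose-graphˡ _ inj₂ (λ _ → refl) inj₂-unitˡ _)
    where
    forget : relabel id unitˡ (graph {⊥} id ⊕ F) ≅ relabel inj₂ id F
    forget = record
      { edges     = mk↔ₛ′ unitˡ inj₂ (λ _ → refl) inj₂-unitˡ
      ; source-to = λ { (inj₂ _) → refl }
      ; target-to = λ { (inj₂ _) → refl }
      ; weight-to = λ { (inj₂ _) → refl }
      }

  unitʳ-natural : (F : Triskell S T) →
                  compose (F ⊕ graph {⊥} id) (graph unitʳ) ≅ compose (graph unitʳ) F
  unitʳ-natural F = compose-graphʳ _ _ ∙ forget ∙ ≅-sym (compose-graphˡ _ inj₁ (λ _ → refl) inj₁-unitʳ _)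
    where
    forget : relabel id unitʳ (F ⊕ graph {⊥} id) ≅ relabel inj₁ id F
    forget = record
      { edges     = mk↔ₛ′ unitʳ inj₁ (λ _ → refl) inj₁-unitʳ
      ; source-to = λ { (inj₁ _) → refl }
      ; target-to = λ { (inj₁ _) → refl }
      ; weight-to = λ { (inj₁ _) → refl }
      }

  swap-natural : (F : Triskell S S′) (G : Triskell T T′) →
                 compose (F ⊕ G) (graph Sum.swap) ≅ compose (graph Sum.swap) (G ⊕ F)
  swap-natural F G = compose-graphʳ _ _ ∙ exchange ∙ ≅-sym (compose-graphˡ _ _ swap-swap swap-swap _)
    where
    exchange : relabel id Sum.swap (F ⊕ G) ≅ relabel Sum.swap id (G ⊕ F)
    exchange = record
      { edges     = mk↔ₛ′ Sum.swap Sum.swap swap-swap swap-swap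
      ; source-to = λ { (inj₁ _) → refl ; (inj₂ _) → refl }
      ; target-to = λ { (inj₁ _) → refl ; (inj₂ _) → refl }
      ; weight-to = λ { (inj₁ _) → refl ; (inj₂ _) → refl }
      }

  triangle : compose (graph (Sum.assocʳ {A = S} {B = ⊥} {C = T})) (graph id ⊕ graph unitˡ) ≅ graph unitʳ ⊕ graph id
  triangle =
    compose-cong ≅-refl (graph-⊕ id unitˡ) ∙ graph-∘ _ _ ∙
    graph-cong (λ { (inj₁ (inj₁ _)) → refl ; (inj₂ _) → refl }) ∙ ≅-sym (graph-⊕ unitʳ id)

  pentagon : compose (graph (Sum.assocʳ {A = S ⊎ T} {B = U} {C = V})) (graph Sum.assocʳ) ≅
             compose (compose (graph Sum.assocʳ ⊕ graph id) (graph Sum.assocʳ)) (graph id ⊕ graph Sum.assocʳ)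
  pentagon =
    graph-∘ _ _ ∙
    graph-cong (λ { (inj₁ (inj₁ (inj₁ _))) → refl ; (inj₁ (inj₁ (inj₂ _))) → refl
                  ; (inj₁ (inj₂ _)) → refl ; (inj₂ _) → refl }) ∙
    ≅-sym (compose-cong (compose-cong (graph-⊕ Sum.assocʳ id) ≅-refl ∙ graph-∘ _ _) (graph-⊕ id Sum.assocʳ) ∙
           graph-∘ _ _)

  hexagon : compose (compose (graph (Sum.assocʳ {A = S} {B = T} {C = U})) (graph Sum.swap)) (graph Sum.assocʳ) ≅
            compose (compose (graph Sum.swap ⊕ graph id) (graph Sum.assocʳ)) (graph id ⊕ graph Sum.swap)
  hexagon =
    compose-cong (graph-∘ _ _) ≅-refl ∙ graph-∘ _ _ ∙
    graph-cong (λ { (inj₁ (inj₁ _)) → refl ; (inj₁ (inj₂ _)) → refl ; (inj₂ _) → refl }) ∙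
    ≅-sym (compose-cong (compose-cong (graph-⊕ Sum.swap id) ≅-refl ∙ graph-∘ _ _) (graph-⊕ id Sum.swap) ∙
           graph-∘ _ _)

  -- Equality of paths, and congruence of the trace

  last-≡ : {F : Triskell (X ⊎ U) (Y ⊎ U)} {p : X ⊎ U} {y : Y} {e e′ : Edge F}
           {s : source F e ≡ p} {s′ : source F e′ ≡ p} {t : target F e ≡ inj₁ y} {t′ : target F e′ ≡ inj₁ y} →
           e ≡ e′ → last {F = F} e s t ≡ last e′ s′ t′
  last-≡ refl = cong₂ (last _) (≡-irrelevant _ _) (≡-irrelevant _ _)

  cons-≡ : {F : Triskell (X ⊎ U) (Y ⊎ U)} {p : X ⊎ U} {y : Y} {u : U} {e e′ : Edge F}
           {s : source F e ≡ p} {s′ : source F e′ ≡ p} {t : target F e ≡ inj₂ u} {t′ : target F e′ ≡ inj₂ u}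
           {π π′ : Path F (inj₂ u) y} →
           e ≡ e′ → π ≡ π′ → cons e s t π ≡ cons e′ s′ t′ π′
  cons-≡ refl refl = cong₂ (λ s t → cons _ s t _) (≡-irrelevant _ _) (≡-irrelevant _ _)

  -- The endpoints are stored with the path, yet `e` determines them. This serves where an edge of
  -- the trace is rebuilt from `e` alone.
  trace-last-≡ : {F : Triskell (X ⊎ U) (Y ⊎ U)} {x x′ : X} {y y′ : Y} {e : Edge F}
                 (s : source F e ≡ inj₁ x) (s′ : source F e ≡ inj₁ x′)
                 (t : target F e ≡ inj₁ y) (t′ : target F e ≡ inj₁ y′) →
                 _≡_ {A = Edge (trace F)} ((x , y) , last e s t) ((x′ , y′) , last e s′ t′)
  trace-last-≡ s s′ t t′
    with refl ← inj₁-injective (trans (sym s) s′) | refl ← inj₁-injective (trans (sym t) t′) =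
    cong (_ ,_) (last-≡ refl)

  trace-≅ : {F : Triskell (X ⊎ U) (Y ⊎ U)} {G : Triskell (X ⊎ V) (Y ⊎ V)}
            (to : ∀ {x y} → Path F (inj₁ x) y → Path G (inj₁ x) y)
            (from : ∀ {x y} → Path G (inj₁ x) y → Path F (inj₁ x) y) →
            (∀ {x y} (π : Path G (inj₁ x) y) → to (from π) ≡ π) →
            (∀ {x y} (π : Path F (inj₁ x) y) → from (to π) ≡ π) →
            (∀ {x y} (π : Path F (inj₁ x) y) → pathWeight (to π) ≡ pathWeight π) →
            trace F ≅ trace G
  trace-≅ to from to-from from-to weight-to = record
    { edges     = mk↔ₛ′ (λ (xy , π) → xy , to π) (λ (xy , π) → xy , from π)
                    (λ (xy , π) → cong (xy ,_) (to-from π)) (λ (xy , π) → cong (xy ,_) (from-to π))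
    ; source-to = λ _ → refl
    ; target-to = λ _ → refl
    ; weight-to = λ (_ , π) → weight-to π
    }

  module _ {F G : Triskell (X ⊎ U) (Y ⊎ U)} (i : F ≅ G) where
    open ≅ i

    mapPath : ∀ {p y} → Path F p y → Path G p y
    mapPath (last e s t)   = last (to e) (trans (source-to e) s) (trans (target-to e) t)
    mapPath (cons e s t π) = cons (to e) (trans (source-to e) s) (trans (target-to e) t) (mapPath π)

    pathWeight-mapPath : ∀ {p y} (π : Path F p y) → pathWeight (mapPath π) ≡ pathWeight π
    pathWeight-mapPath (last e _ _)   = weight-to e
    pathWeight-mapPath (cons e _ _ π) = cong₂ _·_ (weight-to e) (pathWeight-mapPath π)

  mapPath-inverse : {F G : Triskell (X ⊎ U) (Y ⊎ U)} (i : F ≅ G) (j : G ≅ F) →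
                    (∀ e → ≅.to j (≅.to i e) ≡ e) →
                    ∀ {p y} (π : Path F p y) → mapPath j (mapPath i π) ≡ π
  mapPath-inverse i j inv (last e _ _)   = last-≡ (inv e)
  mapPath-inverse i j inv (cons e _ _ π) = cons-≡ (inv e) (mapPath-inverse i j inv π)

  trace-cong : {F G : Triskell (X ⊎ U) (Y ⊎ U)} → F ≅ G → trace F ≅ trace G
  trace-cong i = trace-≅ (mapPath i) (mapPath i⁻¹) (mapPath-inverse i⁻¹ i (≅.to-from i))
                   (mapPath-inverse i i⁻¹ (≅.from-to i)) (pathWeight-mapPath i)
    where i⁻¹ = ≅-sym i

  -- Naturality and sliding

  -- Moving the factor g ⊕ h across f: the paths alternate between edges of
  -- g ⊕ h and of f, and only the initial edge of g stays outside the loop. Both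
  -- naturality on the left (h = id) and sliding (g = id) are instances.
  module Dinaturality (g : Triskell X′ X) (h : Triskell V U) (f : Triskell (X ⊎ U) (Y ⊎ V)) where

    L : Triskell (X′ ⊎ V) (Y ⊎ V)
    L = compose (g ⊕ h) f

    R : Triskell (X ⊎ U) (Y ⊎ U)
    R = compose f (graph id ⊕ h)

    -- A path (d₁f₁)(d₂f₂)...(dₙfₙ) of `L` regroups as d₁ followed by the path (f₁d₂)(f₂d₃)...(fₙ1)
    -- of `R`, where 1 is an identity edge on `Y`.
    Exit : X′ ⊎ V → Y → Set ℓ
    Exit p y = Σ[ d ∈ Edge (g ⊕ h) ] source (g ⊕ h) d ≡ p × Path R (target (g ⊕ h) d) y

    enter : ∀ {p y} d → source (g ⊕ h) d ≡ p → Path R (target (g ⊕ h) d) y → Path L p y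
    enter d r (last ((e , inj₁ _) , q) s refl)      = last ((d , e) , sym s) r q
    enter d r (cons ((e , inj₂ c) , q) s refl π) = cons ((d , e) , sym s) r q (enter (inj₂ c) refl π)

    exit : ∀ {p y} → Path L p y → Exit p y
    exit {y = y} (last ((d , e) , q) s t) = d , s , last ((e , inj₁ y) , t) (sym q) refl
    exit (cons ((d , e) , q) s t π) with exit π
    -- The rest of the path starts in `V`, so its leading edge comes from `h`; an edge of `g` would
    -- start in `X′`.
    ... | inj₂ c , s′ , π′ = d , s , cons ((e , inj₂ c) , trans t (cong inj₂ (sym (inj₂-injective s′)))) (sym q) refl π′

    exit-enter : ∀ {p y} d (r : source (g ⊕ h) d ≡ p) (π : Path R (target (g ⊕ h) d) y) →
                 exit (enter d r π) ≡ (d , r , π)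
    exit-enter d r (last ((e , inj₁ _) , q) s refl) = cong (λ π → d , r , π) (last-≡ (equaliser-≡ refl))
    exit-enter d r (cons ((e , inj₂ c) , q) s refl π)
      rewrite exit-enter (inj₂ c) refl π = cong (λ π → d , r , π) (cons-≡ (equaliser-≡ refl) refl)

    enter-exit : ∀ {p y} (π : Path L p y) → let (d , r , ρ) = exit π in enter d r ρ ≡ π
    enter-exit (last _ _ _) = last-≡ (equaliser-≡ refl)
    enter-exit (cons _ _ _ π) with exit π | enter-exit π
    ... | inj₂ _ , refl , _ | refl = cons-≡ (equaliser-≡ refl) refl

    pathWeight-enter : ∀ {p y} d (r : source (g ⊕ h) d ≡ p) (π : Path R (target (g ⊕ h) d) y) →
                       pathWeight (enter d r π) ≡ weight (g ⊕ h) d · pathWeight π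
    pathWeight-enter d _ (last ((e , inj₁ _) , _) _ refl) = cong (weight (g ⊕ h) d ·_) (sym (·-identityʳ (weight f e)))
    pathWeight-enter d _ (cons ((e , inj₂ c) , _) _ refl π) =
      trans (cong ((weight (g ⊕ h) d · weight f e) ·_) (pathWeight-enter (inj₂ c) refl π))
        (trans (·-assoc (weight (g ⊕ h) d) (weight f e) (weight h c · pathWeight π))
          (cong (weight (g ⊕ h) d ·_) (sym (·-assoc (weight f e) (weight h c) (pathWeight π)))))

    dinatural : compose g (trace R) ≅ trace L
    dinatural = record
      { edges     = mk↔ₛ′ to (λ ((_ , y) , π) → from (exit π)) to-from from-to
      ; source-to = λ { (_ , refl) → refl }
      ; target-to = λ { (_ , refl) → refl }
      ; weight-to = λ { ((d , _ , π) , refl) → pathWeight-enter (inj₁ d) refl π }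
      }
      where
      to : Edge (compose g (trace R)) → Edge (trace L)
      to ((d , (_ , y) , π) , refl) = (source g d , y) , enter (inj₁ d) refl π

      from : ∀ {x y} → Exit (inj₁ x) y → Edge (compose g (trace R))
      from {y = y} (inj₁ d , _ , π) = (d , (target g d , y) , π) , refl

      to-from : ∀ e → to (from (exit (proj₂ e))) ≡ e
      to-from (_ , π) with exit π | enter-exit π
      ... | inj₁ _ , refl , _ | eq = cong (_ ,_) eq

      from-to : ∀ e → from (exit (proj₂ (to e))) ≡ e
      from-to ((d , _ , π) , refl) = cong from (exit-enter (inj₁ d) refl π)

  trace-naturalˡ : (g : Triskell X′ X) (f : Triskell (X ⊎ U) (Y ⊎ U)) →
                   trace (compose (g ⊕ graph id) f) ≅ compose g (trace f)
  trace-naturalˡ g f = ≅-sym (Dinaturality.dinatural g (graph id) f) ∙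
    compose-cong ≅-refl (trace-cong (compose-cong ≅-refl ⊕-id ∙ identityʳ f))

  trace-sliding : (f : Triskell (X ⊎ U) (Y ⊎ V)) (g : Triskell V U) →
                  trace (compose f (graph id ⊕ g)) ≅ trace (compose (graph id ⊕ g) f)
  trace-sliding f g = ≅-sym (identityˡ _) ∙ Dinaturality.dinatural (graph id) g f

  -- Here the extra factor sits at the far end: only the last edge of a path of `L` involves `g`,
  -- and every earlier one is an edge of `f` followed by an identity edge on `U` of weight `ε`.
  module Naturalityʳ (f : Triskell (X ⊎ U) (Y ⊎ U)) (g : Triskell Y Y′) where

    L : Triskell (X ⊎ U) (Y′ ⊎ U)
    L = compose f (g ⊕ graph id)

    Split : X ⊎ U → Y′ → Set ℓ
    Split p y = Σ[ c ∈ Edge g ] target g c ≡ y × Path f p (source g c)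

    split : ∀ {p y} → Path L p y → Split p y
    split (last ((e , inj₁ c) , q) s t)      = c , inj₁-injective t , last e s q
    split (cons ((e , inj₂ u) , q) s refl π) = let (c , t , ρ) = split π in c , t , cons e s q ρ

    join : ∀ {p y} c → target g c ≡ y → Path f p (source g c) → Path L p y
    join c t (last e s q)       = last ((e , inj₁ c) , q) s (cong inj₁ t)
    join c t (cons e {u} s q π) = cons ((e , inj₂ u) , q) s refl (join c t π)

    split-join : ∀ {p y} c (t : target g c ≡ y) (π : Path f p (source g c)) → split (join c t π) ≡ (c , t , π)
    split-join c refl (last e s q)   = refl
    split-join c t    (cons e s q π) rewrite split-join c t π = refl

    join-split : ∀ {p y} (π : Path L p y) → let (c , t , ρ) = split π in join c t ρ ≡ π
    join-split (last ((e , inj₁ c) , q) s t)      = last-≡ refl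
    join-split (cons ((e , inj₂ u) , q) s refl π) = cong (cons _ s refl) (join-split π)

    pathWeight-join : ∀ {p y} c (t : target g c ≡ y) (π : Path f p (source g c)) →
                      pathWeight (join c t π) ≡ pathWeight π · weight g c
    pathWeight-join c t (last e _ _)   = refl
    pathWeight-join c t (cons e _ _ π) =
      trans (cong₂ _·_ (·-identityʳ (weight f e)) (pathWeight-join c t π))
        (sym (·-assoc (weight f e) (pathWeight π) (weight g c)))

    natural : compose (trace f) g ≅ trace L
    natural = record
      { edges     = mk↔ₛ′ to from to-from from-to
      ; source-to = λ { (_ , refl) → refl }
      ; target-to = λ { (_ , refl) → refl }
      ; weight-to = λ { ((((_ , _) , π) , c) , refl) → pathWeight-join c refl π }
      }
      where
      to : Edge (compose (trace f) g) → Edge (trace L)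
      to ((((x , _) , π) , c) , refl) = (x , target g c) , join c refl π

      toEdge : ∀ {x y} → Split (inj₁ x) y → Edge (compose (trace f) g)
      toEdge {x} (c , _ , π) = (((x , source g c) , π) , c) , refl

      from : Edge (trace L) → Edge (compose (trace f) g)
      from (_ , π) = toEdge (split π)

      to-from : ∀ e → to (from e) ≡ e
      to-from (_ , π) with split π | join-split π
      ... | _ , refl , _ | eq = cong (_ ,_) eq

      from-to : ∀ e → from (to e) ≡ e
      from-to (((_ , π) , c) , refl) = cong toEdge (split-join c refl π)

  -- Vanishing

  trace-vanishing-unit : (F : Triskell (X ⊎ ⊥) (Y ⊎ ⊥)) → trace F ≅ relabel unitʳ unitʳ F
  trace-vanishing-unit F = record
    { edges     = mk↔ₛ′ to from (λ _ → refl) λ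
        { (_ , last e s t) → trace-last-≡ (sym (inj₁-unitʳ _)) s (sym (inj₁-unitʳ _)) t
        ; (_ , cons _ {()} _ _ _) }
    ; source-to = λ { (_ , last e s _) → cong unitʳ s ; (_ , cons _ {()} _ _ _) }
    ; target-to = λ { (_ , last e _ t) → cong unitʳ t ; (_ , cons _ {()} _ _ _) }
    ; weight-to = λ { (_ , last e _ _) → refl ; (_ , cons _ {()} _ _ _) }
    }
    where
    to : Edge (trace F) → Edge F
    to (_ , last e _ _) = e
    to (_ , cons _ {()} _ _ _)

    from : Edge F → Edge (trace F)
    from e = (unitʳ (source F e) , unitʳ (target F e)) , last e (sym (inj₁-unitʳ _)) (sym (inj₁-unitʳ _))

  -- The graph of assocˡ. Unlike the equation assocˡ p ≡ p′, it lets unification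
  -- recover p and p′.
  data Reassoc {S T U : Set ℓ} : S ⊎ (T ⊎ U) → (S ⊎ T) ⊎ U → Set ℓ where
    is₁ : ∀ {s} → Reassoc (inj₁ s) (inj₁ (inj₁ s))
    is₂ : ∀ {t} → Reassoc (inj₂ (inj₁ t)) (inj₁ (inj₂ t))
    is₃ : ∀ {u} → Reassoc (inj₂ (inj₂ u)) (inj₂ u)

  into : {q p : S ⊎ (T ⊎ U)} {p′ : (S ⊎ T) ⊎ U} → Reassoc p p′ → q ≡ p → Sum.assocˡ q ≡ p′
  into is₁ refl = refl
  into is₂ refl = refl
  into is₃ refl = refl

  out : {q p : S ⊎ (T ⊎ U)} {p′ : (S ⊎ T) ⊎ U} → Reassoc p p′ → Sum.assocˡ q ≡ p′ → q ≡ p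
  out {q = inj₁ _}        is₁ refl = refl
  out {q = inj₂ (inj₁ _)} is₂ refl = refl
  out {q = inj₂ (inj₂ _)} is₃ refl = refl

  module Vanishing (F : Triskell (X ⊎ (U ⊎ V)) (Y ⊎ (U ⊎ V))) where

    L : Triskell ((X ⊎ U) ⊎ V) ((Y ⊎ U) ⊎ V)
    L = relabel Sum.assocˡ Sum.assocˡ F

    M : Triskell (X ⊎ U) (Y ⊎ U)
    M = trace L

    -- A path of F cut at its visits to U.
    data Nested (p : (X ⊎ U) ⊎ V) (y : Y) : Set ℓ where
      done  : Path L p (inj₁ y) → Nested p y
      visit : ∀ {u} → Path L p (inj₂ u) → Path M (inj₂ u) y → Nested p y

    prepend : ∀ {p v y} e → source L e ≡ p → target L e ≡ inj₂ v → Nested (inj₂ v) y → Nested p y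
    prepend e s t (done π)    = done (cons e s t π)
    prepend e s t (visit π ρ) = visit (cons e s t π) ρ

    -- A `Nested` path may start in `V`, inside a segment that is not yet an edge of `M`; this lets
    -- `nest` proceed edge by edge. Once the start lies in `X` or `U`, the first segment is complete
    -- and becomes an edge of `M`.
    outer : ∀ {p y} → Nested (inj₁ p) y → Path M p y
    outer (done π)    = last (_ , π) refl refl
    outer (visit π ρ) = cons (_ , π) refl refl ρ

    nest : ∀ {p p′ y} → Reassoc p p′ → Path F p y → Nested p′ y
    nest r (last e s t)            = done (last e (into r s) (into is₁ t))
    nest r (cons e {inj₁ u} s t π) =
      visit (last e (into r s) (into is₂ t)) (outer (nest is₂ π))
    nest r (cons e {inj₂ v} s t π) =
      prepend e (into r s) (into is₃ t) (nest is₃ π)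

    flatten : ∀ {p p′ y} → Reassoc p p′ → Path L p′ (inj₁ y) → Path F p y
    flatten r (last e s t)   = last e (out r s) (out is₁ t)
    flatten r (cons e s t π) = cons e (out r s) (out is₃ t) (flatten is₃ π)

    append : ∀ {p p′ u y} → Reassoc p p′ → Path L p′ (inj₂ u) → Path F (inj₂ (inj₁ u)) y → Path F p y
    append r (last e s t)   ρ = cons e (out r s) (out is₂ t) ρ
    append r (cons e s t π) ρ = cons e (out r s) (out is₃ t) (append is₃ π ρ)

    concat : ∀ {p p′ y} → Reassoc p (inj₁ p′) → Path M p′ y → Path F p y
    concat r (last (_ , π) refl refl)   = flatten r π
    concat r (cons (_ , π) refl refl ρ) = append r π (concat is₂ ρ)

    unnest : ∀ {p p′ y} → Reassoc p p′ → Nested p′ y → Path F p y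
    unnest r (done π)    = flatten r π
    unnest r (visit π ρ) = append r π (concat is₂ ρ)

    concat-outer : ∀ {p p′ y} (r : Reassoc p (inj₁ p′)) (ν : Nested (inj₁ p′) y) → concat r (outer ν) ≡ unnest r ν
    concat-outer r (done _)    = refl
    concat-outer r (visit _ _) = refl

    unnest-prepend : ∀ {p p′ v y} (r : Reassoc p p′) e (s : source F e ≡ p) (s′ : source L e ≡ p′)
                     (t : target F e ≡ inj₂ (inj₂ v)) (t′ : target L e ≡ inj₂ v) (ν : Nested (inj₂ v) y) →
                     unnest r (prepend e s′ t′ ν) ≡ cons e s t (unnest is₃ ν)
    unnest-prepend r e s s′ t t′ (done _)    = cons-≡ refl refl
    unnest-prepend r e s s′ t t′ (visit _ _) = cons-≡ refl refl

    unnest-nest : ∀ {p p′ y} (r : Reassoc p p′) (π : Path F p y) → unnest r (nest r π) ≡ π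
    unnest-nest r (last e s t)            = last-≡ refl
    unnest-nest r (cons e {inj₁ u} s t π) = cons-≡ refl (trans (concat-outer is₂ (nest is₂ π)) (unnest-nest is₂ π))
    unnest-nest r (cons e {inj₂ v} s t π) =
      trans (unnest-prepend r e s _ t _ (nest is₃ π)) (cong (cons e s t) (unnest-nest is₃ π))

    nest-flatten : ∀ {p p′ y} (r : Reassoc p p′) (π : Path L p′ (inj₁ y)) → nest r (flatten r π) ≡ done π
    nest-flatten r (last e s t)   = cong done (last-≡ refl)
    nest-flatten r (cons e s t π) rewrite nest-flatten is₃ π = cong done (cons-≡ refl refl)

    nest-append : ∀ {p p′ u y} (r : Reassoc p p′) (π : Path L p′ (inj₂ u)) (ρ : Path F (inj₂ (inj₁ u)) y) →
                  nest r (append r π ρ) ≡ visit π (outer (nest is₂ ρ))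
    nest-append r (last e s t)   ρ = cong (λ π → visit π (outer (nest is₂ ρ))) (last-≡ refl)
    nest-append r (cons e s t π) ρ rewrite nest-append is₃ π ρ = cong (λ π → visit π (outer (nest is₂ ρ))) (cons-≡ refl refl)

    outer-nest-concat : ∀ {p p′ y} (r : Reassoc p (inj₁ p′)) (ρ : Path M p′ y) → outer (nest r (concat r ρ)) ≡ ρ
    outer-nest-concat r (last (_ , π) refl refl) = cong outer (nest-flatten r π)
    outer-nest-concat r (cons (_ , π) refl refl ρ) =
      trans (cong outer (nest-append r π (concat is₂ ρ))) (cong (cons _ refl refl) (outer-nest-concat is₂ ρ))

    pathWeight-flatten : ∀ {p p′ y} (r : Reassoc p p′) (π : Path L p′ (inj₁ y)) →
                         pathWeight (flatten r π) ≡ pathWeight π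
    pathWeight-flatten r (last _ _ _)   = refl
    pathWeight-flatten r (cons e _ _ π) = cong (weight F e ·_) (pathWeight-flatten is₃ π)

    pathWeight-append : ∀ {p p′ u y} (r : Reassoc p p′) (π : Path L p′ (inj₂ u)) (ρ : Path F (inj₂ (inj₁ u)) y) →
                        pathWeight (append r π ρ) ≡ pathWeight π · pathWeight ρ
    pathWeight-append r (last _ _ _)   ρ = refl
    pathWeight-append r (cons e _ _ π) ρ =
      trans (cong (weight F e ·_) (pathWeight-append is₃ π ρ)) (sym (·-assoc (weight F e) (pathWeight π) (pathWeight ρ)))

    pathWeight-concat : ∀ {p p′ y} (r : Reassoc p (inj₁ p′)) (ρ : Path M p′ y) →
                        pathWeight (concat r ρ) ≡ pathWeight ρ
    pathWeight-concat r (last (_ , π) refl refl)   = pathWeight-flatten r π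
    pathWeight-concat r (cons (_ , π) refl refl ρ) =
      trans (pathWeight-append r π (concat is₂ ρ)) (cong (pathWeight π ·_) (pathWeight-concat is₂ ρ))

    vanishing : trace M ≅ trace F
    vanishing = trace-≅ (concat is₁) (outer ∘ nest is₁)
      (λ π → trans (concat-outer is₁ (nest is₁ π)) (unnest-nest is₁ π))
      (outer-nest-concat is₁) (pathWeight-concat is₁)

  -- Superposing and yanking

  incl : S ⊎ U → (T ⊎ S) ⊎ U
  incl = Sum.map₁ inj₂

  -- The graph of incl, for the same reason as Reassoc.
  data Incl {S T U : Set ℓ} : S ⊎ U → (T ⊎ S) ⊎ U → Set ℓ where
    outside : ∀ {s} → Incl (inj₁ s) (inj₁ (inj₂ s))
    inside  : ∀ {u} → Incl (inj₂ u) (inj₂ u)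

  inclInto : {q p : S ⊎ U} {p′ : (T ⊎ S) ⊎ U} → Incl p p′ → q ≡ p → incl q ≡ p′
  inclInto outside refl = refl
  inclInto inside  refl = refl

  inclOut : {q p : S ⊎ U} {p′ : (T ⊎ S) ⊎ U} → Incl p p′ → incl q ≡ p′ → q ≡ p
  inclOut {q = inj₁ _} outside refl = refl
  inclOut {q = inj₂ _} inside  refl = refl

  inclAbsurd : {p : S ⊎ U} {p′ : (T ⊎ S) ⊎ U} {t : T} → Incl p p′ → inj₁ (inj₁ t) ≢ p′
  inclAbsurd outside ()
  inclAbsurd inside  ()

  -- Edges of `g` never touch `U`. Hence a path starting in `W` is a single edge of `g`, and one
  -- starting in `X` or `U` stays among the edges of `f` and cannot end in `Z`.
  module Superposing (g : Triskell W Z) (f : Triskell (X ⊎ U) (Y ⊎ U)) where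

    L : Triskell ((W ⊎ X) ⊎ U) ((Z ⊎ Y) ⊎ U)
    L = relabel Sum.assocˡ Sum.assocˡ (g ⊕ f)

    incl-avoids : {t : T} (p : S ⊎ U) → incl p ≢ inj₁ (inj₁ t)
    incl-avoids (inj₁ _) ()
    incl-avoids (inj₂ _) ()

    include : ∀ {p p′ y} → Incl p p′ → Path f p y → Path L p′ (inj₂ y)
    include r (last e s t)   = last (inj₂ e) (inclInto r s) (inclInto outside t)
    include r (cons e s t π) = cons (inj₂ e) (inclInto r s) (inclInto inside t) (include inside π)

    restrict : ∀ {p p′ y} → Incl p p′ → Path L p′ (inj₂ y) → Path f p y
    restrict r (last (inj₂ e) s t)   = last e (inclOut r s) (inclOut outside t)
    restrict r (cons (inj₂ e) s t π) = cons e (inclOut r s) (inclOut inside t) (restrict inside π)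

    restrict-include : ∀ {p p′ y} (r : Incl p p′) (π : Path f p y) → restrict r (include r π) ≡ π
    restrict-include r (last _ _ _)   = last-≡ refl
    restrict-include r (cons _ _ _ π) = cons-≡ refl (restrict-include inside π)

    include-restrict : ∀ {p p′ y} (r : Incl p p′) (π : Path L p′ (inj₂ y)) → include r (restrict r π) ≡ π
    include-restrict r (last (inj₂ _) _ _)   = last-≡ refl
    include-restrict r (cons (inj₂ _) _ _ π) = cons-≡ refl (include-restrict inside π)

    no-crossing : ∀ {p p′ z} → Incl p p′ → ¬ Path L p′ (inj₁ z)
    no-crossing r (last (inj₁ _) s _)   = inclAbsurd r s
    no-crossing r (last (inj₂ e) _ t)   = incl-avoids (target f e) t
    no-crossing r (cons (inj₂ _) _ _ π) = no-crossing inside π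

    pathWeight-include : ∀ {p p′ y} (r : Incl p p′) (π : Path f p y) → pathWeight (include r π) ≡ pathWeight π
    pathWeight-include r (last _ _ _)   = refl
    pathWeight-include r (cons e _ _ π) = cong (weight f e ·_) (pathWeight-include inside π)

    superposing : g ⊕ trace f ≅ trace L
    superposing = record
      { edges     = mk↔ₛ′ to from to-from from-to
      ; source-to = λ { (inj₁ _) → refl ; (inj₂ _) → refl }
      ; target-to = λ { (inj₁ _) → refl ; (inj₂ _) → refl }
      ; weight-to = λ { (inj₁ _) → refl ; (inj₂ (_ , π)) → pathWeight-include outside π }
      }
      where
      to : Edge (g ⊕ trace f) → Edge (trace L)
      to (inj₁ e)             = (inj₁ (source g e) , inj₁ (target g e)) , last (inj₁ e) refl refl
      to (inj₂ ((x , y) , π)) = (inj₂ x , inj₂ y) , include outside π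

      from : Edge (trace L) → Edge (g ⊕ trace f)
      from ((inj₁ _ , _)      , last (inj₁ e) _ _)   = inj₁ e
      from ((inj₁ _ , _)      , last (inj₂ e) s _)   = contradiction s (incl-avoids (source f e))
      from ((inj₁ _ , _)      , cons (inj₂ e) s _ _) = contradiction s (incl-avoids (source f e))
      from ((inj₂ _ , inj₁ _) , π)                   = contradiction π (no-crossing outside)
      from ((inj₂ x , inj₂ y) , π)                   = inj₂ ((x , y) , restrict outside π)

      to-from : ∀ e → to (from e) ≡ e
      to-from ((inj₁ _ , _)      , last (inj₁ e) s t)   = trace-last-≡ refl s refl t
      to-from ((inj₁ _ , _)      , last (inj₂ e) s _)   = contradiction s (incl-avoids (source f e))
      to-from ((inj₁ _ , _)      , cons (inj₂ e) s _ _) = contradiction s (incl-avoids (source f e))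
      to-from ((inj₂ _ , inj₁ _) , π)                   = contradiction π (no-crossing outside)
      to-from ((inj₂ x , inj₂ y) , π)                   = cong (_ ,_) (include-restrict outside π)

      from-to : ∀ e → from (to e) ≡ e
      from-to (inj₁ _)       = refl
      from-to (inj₂ (_ , π)) = cong (λ π → inj₂ (_ , π)) (restrict-include outside π)

  -- The swap leads from X into U and from U out to Y, so every path has exactly two edges and
  -- weight `ε · ε`.
  trace-yanking : trace (graph (Sum.swap {A = U} {B = U})) ≅ graph id
  trace-yanking = record
    { edges     = mk↔ₛ′ (λ ((x , _) , _) → x)
                    (λ x → (x , x) , cons (inj₁ x) refl refl (last (inj₂ x) refl refl))
                    (λ _ → refl)
                    (λ { (_ , cons _ refl refl (last _ refl refl)) → refl
                       ; (_ , cons _ refl refl (cons _ refl () _)) ; (_ , last _ refl ()) })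
    ; source-to = λ _ → refl
    ; target-to = λ { (_ , cons _ refl refl (last _ refl refl)) → refl
                    ; (_ , cons _ refl refl (cons _ refl () _)) ; (_ , last _ refl ()) }
    ; weight-to = λ { (_ , cons _ refl refl (last _ refl refl)) → sym (·-identityˡ ε)
                    ; (_ , cons _ refl refl (cons _ refl () _)) ; (_ , last _ refl ()) }
    }

  -- Size of the trace, and the theorem

  pathEdges : {F : Triskell (X ⊎ U) (Y ⊎ U)} {p : X ⊎ U} {y : Y} → Path F p y → List (Edge F)
  pathEdges (last e _ _)   = e ∷ []
  pathEdges (cons e _ _ π) = e ∷ pathEdges π

  -- The endpoints are compared along with the paths because the edges determine them too: the first
  -- edge gives the start, the last one the end. So the size of the trace is bounded by the edge set
  -- alone.
  pathEdges-injective : {F : Triskell (X ⊎ U) (Y ⊎ U)} {p p′ : X ⊎ U} {y y′ : Y}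
                        (π : Path F p y) (π′ : Path F p′ y′) → pathEdges π ≡ pathEdges π′ →
                        _≡_ {A = Σ[ (p , y) ∈ (X ⊎ U) × Y ] Path F p y} ((p , y) , π) ((p′ , y′) , π′)
  pathEdges-injective (last _ refl t) (last _ refl t′) refl
    with refl ← inj₁-injective (trans (sym t) t′) = cong (_ ,_) (last-≡ refl)
  pathEdges-injective (cons _ refl t π) (cons _ refl t′ π′) eq
    with refl , eq′ ← ∷-injective eq
    with refl ← inj₂-injective (trans (sym t) t′)
    with refl ← pathEdges-injective π π′ eq′ = cong (_ ,_) (cons-≡ refl refl)
  -- The tail is split once more to expose that its list of edges is nonempty; the two lists then
  -- differ in length.
  pathEdges-injective (last _ _ _) (cons _ _ _ (last _ _ _)) ()
  pathEdges-injective (last _ _ _) (cons _ _ _ (cons _ _ _ _)) ()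
  pathEdges-injective (cons _ _ _ (last _ _ _)) (last _ _ _) ()
  pathEdges-injective (cons _ _ _ (cons _ _ _ _)) (last _ _ _) ()

  traceEdges↣ : (F : Triskell (X ⊎ U) (Y ⊎ U)) → Edge (trace F) ↣ List (Edge F)
  traceEdges↣ F = mk↣ {to = λ (_ , π) → pathEdges π} injective
    where
    injective : ∀ {e e′ : Edge (trace F)} → pathEdges (proj₂ e) ≡ pathEdges (proj₂ e′) → e ≡ e′
    injective {_ , π} {_ , π′} eq with refl ← pathEdges-injective π π′ eq = refl

module _ {ℓ} {Ω : Set ℓ} {_·_ : Op₂ Ω} {ε : Ω} (isMonoid : IsMonoid _≡_ _·_ ε) where
  open Triskells _·_ ε
  open TriskellProperties _·_ ε isMonoid

  closed : (∀ {a} → ExcludedMiddle a) → (∀ {a b} → Extensionality a b) → {κ : Set ℓ} → κ ≥ℵ₁ → Closed κ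
  closed em ext {κ} κ≥ℵ₁ = record
    { ⊥-small       = ≺-downward (mk↣ {to = Poly.⊥-elim} λ { {()} }) κ≥ℵ₁
    ; ⊎-small       = ⊎-≺
    ; compose-small = λ F G E≺κ E′≺κ → ≺-downward (mk↣ {to = proj₁} equaliser-≡) (×-≺ E≺κ E′≺κ)
    ; trace-small   = λ F E≺κ → ≺-downward (traceEdges↣ F) (List-≺ E≺κ)
    }
    where
    open Classical em ext
    open Small κ≥ℵ₁

  isTracedMonoidalCategory : {κ : Set ℓ} (closed : Closed κ) → IsTracedMonoidalCategory (Trisk closed)
  isTracedMonoidalCategory closed = record
    { isCategory = record
      { isEquivalence = record { refl = ≅-refl ; sym = ≅-sym ; trans = ≅-trans }
      ; ⨾-cong        = compose-cong
      ; assoc         = λ f g k → compose-assoc (value f) (value g) (value k)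
      ; identityˡ     = λ f → identityˡ (value f)
      ; identityʳ     = λ f → identityʳ (value f)
      }
    ; isMonoidal = record
      { ⊗-cong    = ⊕-cong
      ; ⊗-idn     = λ _ _ → ⊕-id
      ; ⊗-⨾       = λ f g f′ g′ → ⊕-compose (value f) (value g) (value f′) (value g′)
      ; α-invˡ    = λ _ _ _ → graph-inverse Sum.assocˡ Sum.assocʳ assocʳ-assocˡ
      ; α-invʳ    = λ _ _ _ → graph-inverse Sum.assocʳ Sum.assocˡ assocˡ-assocʳ
      ; λ-invˡ    = λ _ → graph-inverse inj₂ unitˡ λ _ → refl
      ; λ-invʳ    = λ _ → graph-inverse unitˡ inj₂ inj₂-unitˡ
      ; ρ-invˡ    = λ _ → graph-inverse inj₁ unitʳ λ _ → refl
      ; ρ-invʳ    = λ _ → graph-inverse unitʳ inj₁ inj₁-unitʳ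
      ; α-natural = λ f g k → assoc-natural (value f) (value g) (value k)
      ; λ-natural = λ f → unitˡ-natural (value f)
      ; ρ-natural = λ f → unitʳ-natural (value f)
      ; triangle  = λ _ _ → triangle
      ; pentagon  = λ _ _ _ _ → pentagon
      }
    ; isSymmetric = record
      { σ-natural    = λ f g → swap-natural (value f) (value g)
      ; σ-involutive = λ _ _ → graph-inverse Sum.swap Sum.swap swap-swap
      ; hexagon      = λ _ _ _ → hexagon
      }
    ; isTraced = record
      { Tr-cong        = trace-cong
      ; naturalˡ       = λ g f → trace-naturalˡ (value g) (value f)
      ; naturalʳ       = λ f g → ≅-sym (Naturalityʳ.natural (value f) (value g))
      ; sliding        = λ f g → trace-sliding (value f) (value g)
      ; vanishing-unit = λ f → trace-vanishing-unit (value f) ∙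
          ≅-sym (conjugate inj₁ unitʳ inj₁-unitʳ (λ _ → refl) (value f) unitʳ)
      ; vanishing-⊗    = λ f → ≅-sym (Vanishing.vanishing (value f)) ∙
          trace-cong (trace-cong (≅-sym (conjugate-assoc (value f))))
      ; superposing    = λ g f → trace-cong (conjugate-assoc (value g ⊕ value f)) ∙
          ≅-sym (Superposing.superposing (value g) (value f))
      ; yanking        = λ _ → trace-yanking
      }
    }

theorem7 : (∀ {a} → ExcludedMiddle a) → (∀ {a b} → Extensionality a b) →
    ∀ {ℓ} (κ : Set ℓ) → κ ≥ℵ₁ →
    (Ω : Set ℓ) (_·_ : Op₂ Ω) (ε : Ω) → IsMonoid _≡_ _·_ ε → Ω ≺ κ →
    Σ[ closed ∈ Triskells.Closed _·_ ε κ ]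
    IsTracedMonoidalCategory (Triskells.Trisk _·_ ε closed)
theorem7 em ext κ κ≥ℵ₁ Ω _·_ ε isMonoid _ = κ-closed , isTracedMonoidalCategory isMonoid κ-closed
  where
  κ-closed : Triskells.Closed _·_ ε κ
  κ-closed = closed isMonoid em ext κ≥ℵ₁
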